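{- For all problems $f,g$: if $f\le_{\mathrm W}g$, then $f^\infty\le_{\mathrm{sW}}g^\infty$.
   Context: Problems. A represented space $(X,\delta_X)$ is a set $X$ with a surjective partial map $\delta_X:\subseteq\mathbb N^{\mathbb N}\to X$. A partial function $F:\subseteq\mathbb N^{\mathbb N}\to\mathbb N^{\mathbb N}$ is computable if there is a computable monotone (w.r.t. the prefix order) word function $\varphi:\mathbb N^*\to\mathbb N^*$ with $F(p)=\sup_{w\sqsubseteq p}\varphi(w)$ for all $p\in\mathrm{dom}(F)$. For a partial multivalued function $f:\subseteq X\rightrightarrows Y$ between represented spaces, $F:\subseteq\mathbb N^{\mathbb N}\to\mathbb N^{\mathbb N}$ is a realizer of $f$, written $F\vdash f$, if $\delta_YF(p)\in f\delta_X(p)$ for all $p\in\mathrm{dom}(f\delta_X)$. A problem is a multivalued function with a realizer. Composition: $g\circ f(x)=\{z:(\exists y\in f(x))\,z\in g(y)\}$ with $\mathrm{dom}(g\circ f)=\{x\in\mathrm{dom}(f):f(x)\subseteq\mathrm{dom}(g)\}$. The realizer version of $f$ is $f^{\mathrm r}:=\delta_Y^{ -1}\circ f\circ\delta_X:\subseteq\mathbb N^{\mathbb N}\rightrightarrows\mathbb N^{\mathbb N}$. Tupling. $\langle q,p\rangle:=q(0)p(0)q(1)p(1)\dots$, and $\langle p_0,p_1,p_2,\dots\rangle$ is the standard countable tupling, e.g. $\langle p_0,p_1,\dots\rangle(\langle i,j\rangle)=p_i(j)$. $\langle\mathrm{id}\times f\rangle$ is the problem $\langle q,p\rangle\mapsto\{\langle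 q,r\rangle:r\in f(p)\}$. Universal function. $\Phi$ is a fixed standard total representation of a set of continuous partial functions on $\mathbb N^{\mathbb N}$ (with natural domains), where a name $q$ encodes the graph of a monotone word function approximating $\Phi_q$; $\mathsf U_q:=\Phi_q$, and $\mathsf U\langle q,p\rangle:=\mathsf U_q(p)$ is a computable partial function. The smn-theorem holds: for every computable (continuous) $F:\subseteq\mathbb N^{\mathbb N}\to\mathbb N^{\mathbb N}$ there is a total computable (continuous) $S$ with $\mathsf U_{S(q)}(p)=F\langle q,p\rangle$ for all $\langle q,p\rangle\in\mathrm{dom}(F)$. The names $q$ allow the digits $0,1,2$ as dummy symbols: adding or removing them does not change $\mathsf U_q$. Infinite loop. For a problem $f:\subseteq\mathbb N^{\mathbb N}\rightrightarrows\mathbb N^{\mathbb N}$, $f^\infty(q_0):=\{\langle q_0,q_1,q_2,\dots\rangle:(\forall i)\ q_{i+1}\in\mathsf U\circ\langle\mathrm{id}\times f\rangle(q_i)\}$, with $\mathrm{dom}(f^\infty)$ the set of all $q_0$ such that $A_0:=\{q_0\}\subseteq\mathrm{dom}(\mathsf U\circ\langle\mathrm{id}\times f\rangle)$ and $A_{i+1}:=\mathsf U\circ\langle\mathrm{id}\times f\rangle(A_i)\subseteq\mathrm{dom}(\mathsf U\circ\langle\mathrm{id}\times f\rangle)$ for all $i$. For arbitrary $f$, $f^\infty:=(f^{\mathrm r})^\infty$. Reducibilities. $f\le_{\mathrm W}g$ (Weihrauch reducible) if there are computable $H,K:\subseteq\mathbb N^{\mathbb N}\to\mathbb N^{\mathbb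 N}$ with $H\langle\mathrm{id},GK\rangle\vdash f$ whenever $G\vdash g$; $f\le_{\mathrm{sW}}g$ (strongly Weihrauch reducible) if there are computable $H,K$ with $HGK\vdash f$ whenever $G\vdash g$. -}

module Defs where

open import Data.Fin.Base using (Fin; toℕ; fromℕ<)
open import Data.Fin.Properties using (toℕ-fromℕ<)
open import Data.List.Base using (List; []; _∷_; length; lookup)
open import Data.List.Relation.Binary.Prefix.Heterogeneous using (Prefix)
open import Data.Nat.Base using (ℕ; zero; suc; _+_; _<_; _≤_)
open import Data.Nat.Properties using (+-suc; +-comm; +-identityʳ)
open import Data.Product.Base using (Σ; ∃; ∃-syntax; _×_; _,_; proj₁; proj₂)
open import Function.Base using (_∘_)
open import Level using (0ℓ)
open import Relation.Binary.Bundles using (Setoid)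
open import Relation.Binary.PropositionalEquality
  using (_≡_; _≗_; refl; sym; trans; cong; cong₂; subst; _→-setoid_)
open import Relation.Unary using (Pred; _∈_; _⊆_)

-- A partial multivalued function is its graph; its domain is the set of
-- points with at least one value.  Points are compared by setoid equality
-- (pointwise equality on Baire space, as functions are not extensional here).
record _⇉_ (A B : Setoid 0ℓ 0ℓ) : Set₁ where
  private
    module A = Setoid A
    module B = Setoid B
  field
    graph : A.Carrier → B.Carrier → Set
    resp  : ∀ {x x′ y y′} → x A.≈ x′ → y B.≈ y′ → graph x y → graph x′ y′

  dom : Pred A.Carrier 0ℓ
  dom x = ∃ (graph x)

  image : Pred A.Carrier 0ℓ → Pred B.Carrier 0ℓ
  image P y = ∃[ x ] x ∈ P × graph x y

open _⇉_ public

record _⇀_ (A B : Setoid 0ℓ 0ℓ) : Set₁ where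
  field
    multi      : A ⇉ B
    functional : ∀ {x y y′} → graph multi x y → graph multi x y′ →
                 Setoid._≈_ B y y′

open _⇀_ public

infixr 9 _∘ₘ_ _∘ₚ_

-- The first component restricts the domain to those x with f(x) ⊆ dom(g).
_∘ₘ_ : ∀ {A B C} → B ⇉ C → A ⇉ B → A ⇉ C
_∘ₘ_ {A} {B} {C} g f = record
  { graph = λ x z → (∀ y → graph f x y → y ∈ dom g) × (∃[ y ] graph f x y × graph g y z)
  ; resp  = λ { x≈x′ z≈z′ (f⊆g , y , fxy , gyz) →
        (λ y fx′y → f⊆g y (resp f (A.sym x≈x′) B.refl fx′y))
      , y , resp f x≈x′ B.refl fxy , resp g B.refl z≈z′ gyz }
  }
  where
    module A = Setoid A
    module B = Setoid B

_∘ₚ_ : ∀ {A B C} → B ⇀ C → A ⇀ B → A ⇀ C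
_∘ₚ_ {A} {B} {C} G F = record
  { multi      = multi G ∘ₘ multi F
  ; functional = λ { (_ , y , Fxy , Gyz) (_ , y′ , Fxy′ , Gy′z′) →
      functional G
        (resp (multi G) (functional F Fxy Fxy′) (Setoid.refl C) Gyz) Gy′z′ }
  }

_⁻¹ : ∀ {A B} → A ⇉ B → B ⇉ A
f ⁻¹ = record
  { graph = λ y x → graph f x y
  ; resp  = λ y≈y′ x≈x′ → resp f x≈x′ y≈y′
  }

Baire : Set
Baire = ℕ → ℕ

𝔹 : Setoid 0ℓ 0ℓ
𝔹 = ℕ →-setoid ℕ

private module 𝔹 = Setoid 𝔹

Word : Set
Word = List ℕ

infix 4 _⊑_ _≺_

_⊑_ : Word → Word → Set
_⊑_ = Prefix _≡_

_≺_ : Word → Baire → Set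
w ≺ p = ∀ (i : Fin (length w)) → lookup w i ≡ p (toℕ i)

≺-resp : ∀ w {p q} → p ≗ q → w ≺ p → w ≺ q
≺-resp w p≗q w≺p i = trans (w≺p i) (p≗q (toℕ i))

-- p is the supremum of W in ℕ* ∪ ℕ^ℕ with the prefix order: p is an upper
-- bound, and W has members of unbounded length, so that there is no other.
record IsSup (W : Pred Word 0ℓ) (p : Baire) : Set where
  field
    upper     : ∀ {w} → w ∈ W → w ≺ p
    unbounded : ∀ n → ∃[ w ] w ∈ W × n ≤ length w

open IsSup public

IsSup-resp : ∀ {W W′ p q} → W ⊆ W′ → W′ ⊆ W → p ≗ q → IsSup W p → IsSup W′ q
IsSup-resp W⊆W′ W′⊆W p≗q s = record
  { upper     = λ {w} w∈W′ → ≺-resp w p≗q (upper s (W′⊆W w∈W′))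
  ; unbounded = λ n → let w , w∈W , n≤ = unbounded s n in w , W⊆W′ w∈W , n≤
  }

IsSup-unique : ∀ {W p q} → IsSup W p → IsSup W q → p ≗ q
IsSup-unique {W} {p} {q} s t n with unbounded s (suc n)
... | w , w∈W , n<∣w∣ =
  subst (λ k → p k ≡ q k) (toℕ-fromℕ< n<∣w∣)
    (trans (sym (upper s w∈W i)) (upper t w∈W i))
  where i = fromℕ< n<∣w∣

triangle : ℕ → ℕ
triangle zero    = zero
triangle (suc n) = suc n + triangle n

pair : ℕ → ℕ → ℕ
pair i j = triangle (i + j) + j

next : ℕ × ℕ → ℕ × ℕ
next (zero  , j) = suc j , zero
next (suc i , j) = i , suc j

unpair : ℕ → ℕ × ℕ
unpair zero    = zero , zero
unpair (suc n) = next (unpair n)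

private
  unpair-diagonal : ∀ s i j → i + j ≡ s → unpair (triangle s + j) ≡ (i , j)
  unpair-diagonal zero zero zero refl = refl
  unpair-diagonal (suc s) i zero e
    rewrite +-identityʳ (s + triangle s) | +-comm s (triangle s)
          | unpair-diagonal s zero s refl
          = cong (_, zero) (trans (sym e) (+-identityʳ i))
  unpair-diagonal s i (suc j) e
    rewrite +-suc (triangle s) j
          | unpair-diagonal s (suc i) j (trans (sym (+-suc i j)) e) = refl

unpair-pair : ∀ i j → unpair (pair i j) ≡ (i , j)
unpair-pair i j = unpair-diagonal (i + j) i j refl

⟪_,_⟫ : Baire → Baire → Baire
⟪ q , p ⟫ zero    = q zero
⟪ q , p ⟫ (suc n) = ⟪ p , q ∘ suc ⟫ n

⟪⟫-cong : ∀ {q q′ p p′} → q ≗ q′ → p ≗ p′ → ⟪ q , p ⟫ ≗ ⟪ q′ , p′ ⟫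
⟪⟫-cong q≗q′ p≗p′ zero    = q≗q′ zero
⟪⟫-cong q≗q′ p≗p′ (suc n) = ⟪⟫-cong p≗p′ (q≗q′ ∘ suc) n

⟪⟫-injectiveˡ : ∀ {q q′ p p′} → ⟪ q , p ⟫ ≗ ⟪ q′ , p′ ⟫ → q ≗ q′
⟪⟫-injectiveˡ e zero    = e zero
⟪⟫-injectiveˡ e (suc n) = ⟪⟫-injectiveˡ (e ∘ suc ∘ suc) n

⟪⟫-injectiveʳ : ∀ {q q′ p p′} → ⟪ q , p ⟫ ≗ ⟪ q′ , p′ ⟫ → p ≗ p′
⟪⟫-injectiveʳ e = ⟪⟫-injectiveˡ (e ∘ suc)

tuple : (ℕ → Baire) → Baire
tuple s n = s (proj₁ (unpair n)) (proj₂ (unpair n))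

tuple-pair : ∀ s i j → tuple s (pair i j) ≡ s i j
tuple-pair s i j = cong (λ k → s (proj₁ k) (proj₂ k)) (unpair-pair i j)

-- The partial recursive functions on data built from ℕ by products and
-- lists: closed under primitive recursion (on ℕ and on lists) and
-- minimisation.

infixr 5 _⊗_

data Ty : Set where
  nat  : Ty
  _⊗_  : Ty → Ty → Ty
  list : Ty → Ty

⟦_⟧ : Ty → Set
⟦ nat ⟧    = ℕ
⟦ σ ⊗ τ ⟧  = ⟦ σ ⟧ × ⟦ τ ⟧
⟦ list τ ⟧ = List ⟦ τ ⟧

infixr 9 _∙_

data Code : Ty → Ty → Set where
  id      : ∀ {σ} → Code σ σ
  _∙_     : ∀ {σ τ ρ} → Code τ ρ → Code σ τ → Code σ ρ
  ⟨_,_⟩   : ∀ {σ τ ρ} → Code σ τ → Code σ ρ → Code σ (τ ⊗ ρ)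
  fst     : ∀ {σ τ} → Code (σ ⊗ τ) σ
  snd     : ∀ {σ τ} → Code (σ ⊗ τ) τ
  zero    : ∀ {σ} → Code σ nat
  suc     : Code nat nat
  natrec  : ∀ {σ τ} → Code σ τ → Code (σ ⊗ nat ⊗ τ) τ → Code (σ ⊗ nat) τ
  nil     : ∀ {σ τ} → Code σ (list τ)
  cons    : ∀ {τ} → Code (τ ⊗ list τ) (list τ)
  listrec : ∀ {σ τ ρ} → Code σ τ → Code (σ ⊗ ρ ⊗ list ρ ⊗ τ) τ →
            Code (σ ⊗ list ρ) τ
  mu      : ∀ {σ} → Code (σ ⊗ nat) nat → Code σ nat

infix 4 _·_⇓_

data _·_⇓_ : ∀ {σ τ} → Code σ τ → ⟦ σ ⟧ → ⟦ τ ⟧ → Set where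
  ⇓id   : ∀ {σ} {x : ⟦ σ ⟧} → id {σ} · x ⇓ x
  ⇓∙    : ∀ {σ τ ρ} {c : Code τ ρ} {d : Code σ τ} {x y z} →
          d · x ⇓ y → c · y ⇓ z → c ∙ d · x ⇓ z
  ⇓⟨⟩   : ∀ {σ τ ρ} {c : Code σ τ} {d : Code σ ρ} {x y z} →
          c · x ⇓ y → d · x ⇓ z → ⟨ c , d ⟩ · x ⇓ (y , z)
  ⇓fst  : ∀ {σ τ} {x : ⟦ σ ⟧} {y : ⟦ τ ⟧} → fst {σ} {τ} · (x , y) ⇓ x
  ⇓snd  : ∀ {σ τ} {x : ⟦ σ ⟧} {y : ⟦ τ ⟧} → snd {σ} {τ} · (x , y) ⇓ y
  ⇓zero : ∀ {σ} {x : ⟦ σ ⟧} → zero {σ} · x ⇓ 0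
  ⇓suc  : ∀ {n} → suc · n ⇓ suc n
  ⇓natrec-zero : ∀ {σ τ} {c : Code σ τ} {d : Code (σ ⊗ nat ⊗ τ) τ} {x y} →
          c · x ⇓ y → natrec c d · (x , 0) ⇓ y
  ⇓natrec-suc : ∀ {σ τ} {c : Code σ τ} {d : Code (σ ⊗ nat ⊗ τ) τ} {x n y z} →
          natrec c d · (x , n) ⇓ y → d · (x , n , y) ⇓ z →
          natrec c d · (x , suc n) ⇓ z
  ⇓nil  : ∀ {σ τ} {x : ⟦ σ ⟧} → nil {σ} {τ} · x ⇓ []
  ⇓cons : ∀ {τ} {a : ⟦ τ ⟧} {as} → cons {τ} · (a , as) ⇓ (a ∷ as)
  ⇓listrec-nil : ∀ {σ τ ρ} {c : Code σ τ} {d : Code (σ ⊗ ρ ⊗ list ρ ⊗ τ) τ}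
          {x y} → c · x ⇓ y → listrec c d · (x , []) ⇓ y
  ⇓listrec-cons : ∀ {σ τ ρ} {c : Code σ τ} {d : Code (σ ⊗ ρ ⊗ list ρ ⊗ τ) τ}
          {x a as y z} →
          listrec c d · (x , as) ⇓ y → d · (x , a , as , y) ⇓ z →
          listrec c d · (x , a ∷ as) ⇓ z
  ⇓mu   : ∀ {σ} {c : Code (σ ⊗ nat) nat} {x n} →
          (∀ m → m < n → ∃[ k ] c · (x , m) ⇓ suc k) → c · (x , n) ⇓ 0 →
          mu c · x ⇓ n

ComputableWordFunction : (Word → Word) → Set
ComputableWordFunction φ =
  Σ (Code (list nat) (list nat)) λ c → ∀ w → c · w ⇓ φ w

Monotone : (Word → Word) → Set
Monotone φ = ∀ {u v} → u ⊑ v → φ u ⊑ φ v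

Computable : 𝔹 ⇀ 𝔹 → Set
Computable F = Σ (Word → Word) λ φ →
  ComputableWordFunction φ × Monotone φ ×
  (∀ {p q} → graph (multi F) p q → IsSup (λ v → ∃[ w ] w ≺ p × v ≡ φ w) q)

record RepresentedSpace : Set₁ where
  field
    setoid     : Setoid 0ℓ 0ℓ
    δ          : 𝔹 ⇀ setoid
    surjective : ∀ x → ∃[ p ] graph (multi δ) p x

  rep : 𝔹 ⇉ setoid
  rep = multi δ

open RepresentedSpace public using (setoid; rep)

infix 4 _⊢_

_⊢_ : ∀ {X Y} → 𝔹 ⇀ 𝔹 → setoid X ⇉ setoid Y → Set
_⊢_ {X} {Y} F f = ∀ {p} → p ∈ dom (f ∘ₘ rep X) →
  ∃[ q ] graph (multi F) p q ×
    (∃[ y ] graph (rep Y) q y × graph (f ∘ₘ rep X) p y)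

record Problem (X Y : RepresentedSpace) : Set₁ where
  field
    fun      : setoid X ⇉ setoid Y
    realizer : Σ (𝔹 ⇀ 𝔹) λ F → _⊢_ {X} {Y} F fun

open Problem public

idₚ : ∀ {A} → A ⇀ A
idₚ {A} = record
  { multi = record
    { graph = A._≈_
    ; resp  = λ x≈x′ y≈y′ x≈y → A.trans (A.sym x≈x′) (A.trans x≈y y≈y′)
    }
  ; functional = λ x≈y x≈y′ → A.trans (A.sym x≈y) x≈y′
  }
  where module A = Setoid A

BaireSpace : RepresentedSpace
BaireSpace = record
  { setoid = 𝔹 ; δ = idₚ ; surjective = λ p → p , 𝔹.refl }

_ʳ : ∀ {X Y} → Problem X Y → Problem BaireSpace BaireSpace
_ʳ {X} {Y} f = record
  { fun      = fʳ
  ; realizer = F , λ { {p} (r , id⊆fʳ , p′ , p≗p′ , fʳp′r) →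
      let (fδ⊆δY⁻¹ , y , fδp′y , _) = fʳp′r
          fδpy = resp fδ {y = y} (𝔹.sym p≗p′) Y.refl fδp′y
          (q , Fpq , z , δYqz , fδpz) = F⊢f (y , fδpy)
      in q , Fpq , q , 𝔹.refl , id⊆fʳ , p , 𝔹.refl
       , (λ y′ fδpy′ → fδ⊆δY⁻¹ y′ (resp fδ p≗p′ Y.refl fδpy′)) , z , fδpz , δYqz }
  }
  where
    module Y = Setoid (setoid Y)
    F   = proj₁ (realizer f)
    F⊢f = proj₂ (realizer f)
    fδ  = fun f ∘ₘ rep X
    fʳ  = rep Y ⁻¹ ∘ₘ fδ

codeWord : Word → ℕ
codeWord []      = zero
codeWord (n ∷ w) = suc (pair n (codeWord w))

-- A name enumerates the graph of a word function, given by pairs of words;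
-- the digits 0, 1, 2 are dummies.
_∋⟨_,_⟩ : Baire → Word → Word → Set
q ∋⟨ u , v ⟩ = ∃[ k ] q k ≡ 3 + pair (codeWord u) (codeWord v)

-- Approximations of Φ_q(p).  Every q is a name: where the enumerated pairs
-- contradict each other, or yield only finitely many digits, Φ_q is undefined.
approximations : Baire → Baire → Pred Word 0ℓ
approximations q p v = ∃[ u ] u ≺ p × q ∋⟨ u , v ⟩

approximations-resp : ∀ {q q′ p p′} → q ≗ q′ → p ≗ p′ →
                      approximations q p ⊆ approximations q′ p′
approximations-resp q≗q′ p≗p′ (u , u≺p , k , e) =
  u , ≺-resp u p≗p′ u≺p , k , trans (sym (q≗q′ k)) e

Φ-resp : ∀ {q q′ p p′ r r′} → q ≗ q′ → p ≗ p′ → r ≗ r′ →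
         IsSup (approximations q p) r → IsSup (approximations q′ p′) r′
Φ-resp {q} {q′} {p} {p′} q≗q′ p≗p′ = IsSup-resp
  (approximations-resp {q} {q′} {p} {p′} q≗q′ p≗p′)
  (approximations-resp {q′} {q} {p′} {p} (𝔹.sym q≗q′) (𝔹.sym p≗p′))

Φ : Baire → 𝔹 ⇀ 𝔹
Φ q = record
  { multi = record
    { graph = λ p → IsSup (approximations q p)
    ; resp  = Φ-resp {q} {q} 𝔹.refl
    }
  ; functional = IsSup-unique
  }

U : 𝔹 ⇀ 𝔹
U = record
  { multi = record
    { graph = λ x r → ∃[ q ] ∃[ p ] x ≗ ⟪ q , p ⟫ × graph (multi (Φ q)) p r
    ; resp  = λ { x≗x′ r≗r′ (q , p , e , s) →
        q , p , 𝔹.trans (𝔹.sym x≗x′) e , resp (multi (Φ q)) {p} 𝔹.refl r≗r′ s }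
    }
  ; functional = λ { (q , p , e , s) (q′ , p′ , e′ , s′) →
      let e″ = 𝔹.trans (𝔹.sym e) e′ in
      IsSup-unique
        (Φ-resp {q} {q′} {p} {p′} (⟪⟫-injectiveˡ e″) (⟪⟫-injectiveʳ e″) 𝔹.refl s)
        s′ }
  }

⟨id×_⟩ : 𝔹 ⇉ 𝔹 → 𝔹 ⇉ 𝔹
⟨id× f ⟩ = record
  { graph = λ x y → ∃[ q ] ∃[ p ] ∃[ r ]
      x ≗ ⟪ q , p ⟫ × y ≗ ⟪ q , r ⟫ × graph f p r
  ; resp  = λ { x≗x′ y≗y′ (q , p , r , ex , ey , fpr) →
      q , p , r , 𝔹.trans (𝔹.sym x≗x′) ex , 𝔹.trans (𝔹.sym y≗y′) ey , fpr }
  }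

step : 𝔹 ⇉ 𝔹 → 𝔹 ⇉ 𝔹
step f = multi U ∘ₘ ⟨id× f ⟩

stage : 𝔹 ⇉ 𝔹 → Baire → ℕ → Pred Baire 0ℓ
stage f q₀ zero    = _≗ q₀
stage f q₀ (suc i) = image (step f) (stage f q₀ i)

loopDom : 𝔹 ⇉ 𝔹 → Pred Baire 0ℓ
loopDom f q₀ = ∀ i → stage f q₀ i ⊆ dom (step f)

IsRun : 𝔹 ⇉ 𝔹 → Baire → (ℕ → Baire) → Set
IsRun f q₀ s = s 0 ≗ q₀ × (∀ i → graph (step f) (s i) (s (suc i)))

stage-resp : ∀ {f q₀ q₀′} → q₀ ≗ q₀′ → ∀ i → stage f q₀ i ⊆ stage f q₀′ i
stage-resp e zero    x≗q₀          = 𝔹.trans x≗q₀ e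
stage-resp {f} e (suc i) (x , x∈Aᵢ , xy) = x , stage-resp {f} e i x∈Aᵢ , xy

loopDom-resp : ∀ {f q₀ q₀′} → q₀ ≗ q₀′ → loopDom f q₀ → loopDom f q₀′
loopDom-resp {f} e d i x∈Aᵢ = d i (stage-resp {f} (𝔹.sym e) i x∈Aᵢ)

loop : 𝔹 ⇉ 𝔹 → 𝔹 ⇉ 𝔹
loop f = record
  { graph = λ q₀ t → q₀ ∈ loopDom f × (∃[ s ] IsRun f q₀ s × t ≗ tuple s)
  ; resp  = λ { q≗q′ t≗t′ (d , s , (s₀ , run) , e) →
        loopDom-resp {f} q≗q′ d
      , s , (𝔹.trans s₀ q≗q′ , run) , 𝔹.trans (𝔹.sym t≗t′) e }
  }

module LoopRealizer (f : Problem BaireSpace BaireSpace) where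

  private
    f₀  = fun f
    F   = proj₁ (realizer f)
    F⊢f = proj₂ (realizer f)

    F-value : ∀ {p} → p ∈ dom f₀ → ∃[ r ] graph (multi F) p r × graph f₀ p r
    F-value {p} (r , fpr) with F⊢f {p}
      ( r , (λ p′ p≗p′ → r , resp f₀ p≗p′ 𝔹.refl fpr) , p , 𝔹.refl , fpr)
    ... | q , Fpq , y , q≗y , _ , p′ , p≗p′ , fp′y =
      q , Fpq , resp f₀ (𝔹.sym p≗p′) (𝔹.sym q≗y) fp′y

    F⊆f : ∀ {p r} → p ∈ dom f₀ → graph (multi F) p r → graph f₀ p r
    F⊆f p∈dom Fpr with F-value p∈dom
    ... | r′ , Fpr′ , fpr′ = resp f₀ 𝔹.refl (functional F Fpr′ Fpr) fpr′

    StepF : Baire → Baire → Set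
    StepF x y = graph (step f₀) x y ×
      (∃[ q ] ∃[ p ] ∃[ r ] x ≗ ⟪ q , p ⟫ × graph (multi F) p r
                          × graph (multi U) ⟪ q , r ⟫ y)

    stepF-total : ∀ {x} → x ∈ dom (step f₀) → ∃ (StepF x)
    stepF-total (_ , ⊆U , _ , (q , p , r , ex , _ , fpr) , _)
      with F-value (r , fpr)
    ... | r′ , Fpr′ , fpr′ with ⊆U _ (q , p , r′ , ex , 𝔹.refl , fpr′)
    ... | y , Uy =
      y , (⊆U , ⟪ q , r′ ⟫ , (q , p , r′ , ex , 𝔹.refl , fpr′) , Uy)
        , q , p , r′ , ex , Fpr′ , Uy

    stepF-functional : ∀ {x x′ y y′} → x ≗ x′ → StepF x y → StepF x′ y′ → y ≗ y′
    stepF-functional x≗x′ (_ , q , p , r , e , Fpr , Uy)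
                          (_ , q′ , p′ , r′ , e′ , Fp′r′ , Uy′) =
      functional U (resp (multi U) (⟪⟫-cong q≗q′ r≗r′) 𝔹.refl Uy) Uy′
      where
        e″   = 𝔹.trans (𝔹.sym e) (𝔹.trans x≗x′ e′)
        q≗q′ = ⟪⟫-injectiveˡ e″
        r≗r′ = functional F
                 (resp (multi F) (⟪⟫-injectiveʳ e″) 𝔹.refl Fpr) Fp′r′

    RunF : Baire → (ℕ → Baire) → Set
    RunF q₀ s = s 0 ≗ q₀ × (∀ i → StepF (s i) (s (suc i)))

    runF-unique : ∀ {q₀ s s′} → RunF q₀ s → RunF q₀ s′ → ∀ i → s i ≗ s′ i
    runF-unique (s₀ , _) (s₀′ , _) zero = 𝔹.trans s₀ (𝔹.sym s₀′)
    runF-unique S@(_ , run) S′@(_ , run′) (suc i) =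
      stepF-functional (runF-unique S S′ i) (run i) (run′ i)

    module _ {q₀} (d : q₀ ∈ loopDom f₀) where
      states : ∀ i → ∃ (stage f₀ q₀ i)
      states zero    = q₀ , 𝔹.refl
      states (suc i) =
        let x , x∈Aᵢ = states i
            y , xy   = stepF-total (d i x∈Aᵢ)
        in y , x , x∈Aᵢ , proj₁ xy

      runF-exists : ∃ (RunF q₀)
      runF-exists = (λ i → proj₁ (states i)) , 𝔹.refl
        , λ i → proj₂ (stepF-total (d i (proj₂ (states i))))

  R : 𝔹 ⇀ 𝔹
  R = record
    { multi = record
      { graph = λ q₀ t → ∃[ s ] RunF q₀ s × t ≗ tuple s
      ; resp  = λ { q≗q′ t≗t′ (s , (s₀ , run) , e) →
          s , (𝔹.trans s₀ q≗q′ , run) , 𝔹.trans (𝔹.sym t≗t′) e }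
      }
    ; functional = λ { (s , S , e) (s′ , S′ , e′) n →
        trans (e n) (trans (runF-unique S S′ _ _) (sym (e′ n))) }
    }

  R⊢loop : _⊢_ {BaireSpace} {BaireSpace} R (loop f₀)
  R⊢loop {q₀} (_ , id⊆loop , _) with id⊆loop q₀ 𝔹.refl
  ... | _ , d , _ with runF-exists d
  ... | s , S@(s₀ , run) =
      tuple s , (s , S , 𝔹.refl) , tuple s , 𝔹.refl
    , id⊆loop , q₀ , 𝔹.refl
    , d , s , (s₀ , proj₁ ∘ run) , 𝔹.refl

-- Used also for f on Baire space, where fʳ has the same graph as f.
_^∞ : ∀ {X Y} → Problem X Y → Problem BaireSpace BaireSpace
f ^∞ = record
  { fun      = loop (fun (f ʳ))
  ; realizer = LoopRealizer.R (f ʳ) , LoopRealizer.R⊢loop (f ʳ)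
  }

⟨id,_⟩ : 𝔹 ⇀ 𝔹 → 𝔹 ⇀ 𝔹
⟨id, F ⟩ = record
  { multi = record
    { graph = λ p y → ∃[ r ] graph (multi F) p r × y ≗ ⟪ p , r ⟫
    ; resp  = λ { p≗p′ y≗y′ (r , Fpr , e) →
        r , resp (multi F) p≗p′ 𝔹.refl Fpr
          , 𝔹.trans (𝔹.sym y≗y′) (𝔹.trans e (⟪⟫-cong p≗p′ 𝔹.refl)) }
    }
  ; functional = λ { (r , Fpr , e) (r′ , Fpr′ , e′) →
      𝔹.trans e (𝔹.trans (⟪⟫-cong 𝔹.refl (functional F Fpr Fpr′)) (𝔹.sym e′)) }
  }

infix 4 _≤W_ _≤sW_

_≤W_ : ∀ {X Y Z W} → Problem X Y → Problem Z W → Set₁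
_≤W_ {X} {Y} {Z} {W} f g = Σ (𝔹 ⇀ 𝔹) λ H → Σ (𝔹 ⇀ 𝔹) λ K →
  Computable H × Computable K ×
  (∀ G → _⊢_ {Z} {W} G (fun g) →
    _⊢_ {X} {Y} (H ∘ₚ ⟨id, G ∘ₚ K ⟩) (fun f))

_≤sW_ : ∀ {X Y Z W} → Problem X Y → Problem Z W → Set₁
_≤sW_ {X} {Y} {Z} {W} f g = Σ (𝔹 ⇀ 𝔹) λ H → Σ (𝔹 ⇀ 𝔹) λ K →
  Computable H × Computable K ×
  (∀ G → _⊢_ {Z} {W} G (fun g) →
    _⊢_ {X} {Y} (H ∘ₚ G ∘ₚ K) (fun f))

module Submission where

-- A state x = ⟪ q , p ⟫ of the loop of f is simulated by ⟪ S x , K p ⟫, where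
-- S x is a name of the function that sends an answer r ∈ g (K p) to the
-- simulation of the next state y = Φ_q (H ⟪ p , r ⟫).  Thus S refers to itself.
-- On words no recursion theorem is needed: the entries of S x that follow from
-- an entry (u , v) of q only involve the translation of the prefix v of y, and
-- v has a smaller code than the prefix of x that contains this entry, so the
-- translation of words is a course-of-values recursion.  Additional harmless
-- entries of S x store x, so that the run of f can be read off the run of g.

open import Defs
open import Axiom.ExcludedMiddle using (ExcludedMiddle)
open import Level using (0ℓ)

open import Data.List.Base using (List; []; _∷_; _∷ʳ_; length; applyUpTo; drop)
open import Data.List.Properties using (length-applyUpTo; applyUpTo-∷ʳ)
open import Data.List.Relation.Binary.Prefix.Heterogeneous using ([]; _∷_)
open import Data.Fin.Base using (zero; suc)
open import Data.Nat.Base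
open import Data.Nat.Properties
open import Data.Product.Base using (∃; ∃-syntax; _×_; _,_; proj₁; proj₂)
open import Data.Sum.Base using (_⊎_; inj₁; inj₂)
open import Function.Base using (_∘_)
open import Relation.Binary.Bundles using (Setoid)
open import Relation.Binary.PropositionalEquality hiding (resp; setoid)
open import Relation.Nullary using (¬_; yes; no; contradiction)
open import Relation.Unary using (_∈_)

private
  variable
    A : Set
    Γ σ τ ρ : Ty

-- Total recursive functions

record Total (σ τ : Ty) (f : ⟦ σ ⟧ → ⟦ τ ⟧) : Set where
  constructor total
  field
    code      : Code σ τ
    evaluates : ∀ x → code · x ⇓ f x

open Total

Total-ext : ∀ {f g} → (∀ x → f x ≡ g x) → Total σ τ f → Total σ τ g
Total-ext f≗g (total c e) = total c λ x → subst (c · x ⇓_) (f≗g x) (e x)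

infixr 9 _∘ᵗ_
infixr 4 _,ᵗ_

_∘ᵗ_ : ∀ {f g} → Total τ ρ g → Total σ τ f → Total σ ρ (λ x → g (f x))
total c e ∘ᵗ total c′ e′ = total (c ∙ c′) λ x → ⇓∙ (e′ x) (e _)

_,ᵗ_ : ∀ {f g} → Total σ τ f → Total σ ρ g → Total σ (τ ⊗ ρ) (λ x → f x , g x)
total c e ,ᵗ total c′ e′ = total ⟨ c , c′ ⟩ λ x → ⇓⟨⟩ (e x) (e′ x)

idᵗ : Total σ σ (λ x → x)
idᵗ = total id λ _ → ⇓id

fstᵗ : Total (σ ⊗ τ) σ proj₁
fstᵗ = total fst λ _ → ⇓fst

sndᵗ : Total (σ ⊗ τ) τ proj₂
sndᵗ = total snd λ _ → ⇓snd

zeroᵗ : Total σ nat (λ _ → 0)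
zeroᵗ = total zero λ _ → ⇓zero

sucᵗ : ∀ {f} → Total σ nat f → Total σ nat (λ x → suc (f x))
sucᵗ f = total suc (λ _ → ⇓suc) ∘ᵗ f

nilᵗ : Total σ (list τ) (λ _ → [])
nilᵗ = total nil λ _ → ⇓nil

consᵗ : ∀ {f g} → Total σ τ f → Total σ (list τ) g →
        Total σ (list τ) (λ x → f x ∷ g x)
consᵗ f g = total cons (λ _ → ⇓cons) ∘ᵗ (f ,ᵗ g)

-- It is enough that `f` satisfies the recursion equations, so functions keep their usual
-- definitions.
natrecᵗ : (f : ⟦ Γ ⟧ → ℕ → ⟦ τ ⟧) → ∀ {z s n} →
          Total Γ τ z → Total (Γ ⊗ nat ⊗ τ) τ s →
          (∀ γ → f γ 0 ≡ z γ) → (∀ γ n → f γ (suc n) ≡ s (γ , n , f γ n)) →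
          Total Γ nat n → Total Γ τ (λ γ → f γ (n γ))
natrecᵗ f (total c e) (total c′ e′) f0 fs n =
  total (natrec c c′) (λ (γ , k) → go γ k) ∘ᵗ (idᵗ ,ᵗ n)
  where
  go : ∀ γ k → natrec c c′ · (γ , k) ⇓ f γ k
  go γ zero    = subst (_ · _ ⇓_) (sym (f0 γ)) (⇓natrec-zero (e γ))
  go γ (suc k) = subst (_ · _ ⇓_) (sym (fs γ k)) (⇓natrec-suc (go γ k) (e′ _))

listrecᵗ : (f : ⟦ Γ ⟧ → List ⟦ ρ ⟧ → ⟦ τ ⟧) → ∀ {z s l} →
           Total Γ τ z → Total (Γ ⊗ ρ ⊗ list ρ ⊗ τ) τ s →
           (∀ γ → f γ [] ≡ z γ) →
           (∀ γ a as → f γ (a ∷ as) ≡ s (γ , a , as , f γ as)) →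
           Total Γ (list ρ) l → Total Γ τ (λ γ → f γ (l γ))
listrecᵗ f (total c e) (total c′ e′) f0 fs l =
  total (listrec c c′) (λ (γ , k) → go γ k) ∘ᵗ (idᵗ ,ᵗ l)
  where
  go : ∀ γ k → listrec c c′ · (γ , k) ⇓ f γ k
  go γ []       = subst (_ · _ ⇓_) (sym (f0 γ)) (⇓listrec-nil (e γ))
  go γ (a ∷ as) = subst (_ · _ ⇓_) (sym (fs γ a as)) (⇓listrec-cons (go γ as) (e′ _))

natCase : A → (ℕ → A) → ℕ → A
natCase z s zero    = z
natCase z s (suc n) = s n

natCaseᵗ : ∀ {z : ⟦ Γ ⟧ → ⟦ τ ⟧} {s : ⟦ Γ ⊗ nat ⟧ → ⟦ τ ⟧} {n} →
           Total Γ τ z → Total (Γ ⊗ nat) τ s → Total Γ nat n →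
           Total Γ τ (λ γ → natCase (z γ) (λ m → s (γ , m)) (n γ))
natCaseᵗ {z = z} {s} ζ ς =
  natrecᵗ (λ γ → natCase (z γ) (λ m → s (γ , m)))
    ζ (ς ∘ᵗ (fstᵗ ,ᵗ fstᵗ ∘ᵗ sndᵗ)) (λ _ → refl) (λ _ _ → refl)

infixl 6 _+ᵗ_ _∸ᵗ_
infixl 7 _⊓ᵗ_

_+ᵗ_ : ∀ {f g} → Total Γ nat f → Total Γ nat g → Total Γ nat (λ γ → f γ + g γ)
_+ᵗ_ {g = g} φ ψ =
  natrecᵗ (λ γ m → m + g γ) ψ (sucᵗ (sndᵗ ∘ᵗ sndᵗ)) (λ _ → refl) (λ _ _ → refl) φ

predᵗ : ∀ {f} → Total Γ nat f → Total Γ nat (λ γ → pred (f γ))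
predᵗ = natrecᵗ (λ _ → pred) zeroᵗ (fstᵗ ∘ᵗ sndᵗ) (λ _ → refl) (λ _ _ → refl)

_∸ᵗ_ : ∀ {f g} → Total Γ nat f → Total Γ nat g → Total Γ nat (λ γ → f γ ∸ g γ)
_∸ᵗ_ {f = f} φ =
  natrecᵗ (λ γ n → f γ ∸ n) φ (predᵗ (sndᵗ ∘ᵗ sndᵗ)) (λ _ → refl)
    (λ γ n → sym (pred[m∸n]≡m∸[1+n] (f γ) n))

∸-∸-⊓ : ∀ m n → m ∸ (m ∸ n) ≡ m ⊓ n
∸-∸-⊓ m n with ≤-total m n
... | inj₁ m≤n rewrite m≤n⇒m∸n≡0 m≤n = sym (m≤n⇒m⊓n≡m m≤n)
... | inj₂ n≤m = trans (m∸[m∸n]≡n n≤m) (sym (m≥n⇒m⊓n≡n n≤m))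

_⊓ᵗ_ : ∀ {f g} → Total Γ nat f → Total Γ nat g → Total Γ nat (λ γ → f γ ⊓ g γ)
_⊓ᵗ_ {f = f} {g} φ ψ = Total-ext (λ γ → ∸-∸-⊓ (f γ) (g γ)) (φ ∸ᵗ (φ ∸ᵗ ψ))

pairᵗ : ∀ {f g} → Total Γ nat f → Total Γ nat g → Total Γ nat (λ γ → pair (f γ) (g γ))
pairᵗ φ ψ = triangleᵗ (φ +ᵗ ψ) +ᵗ ψ
  where
  triangleᵗ : ∀ {f} → Total Γ nat f → Total Γ nat (λ γ → triangle (f γ))
  triangleᵗ = natrecᵗ (λ _ → triangle) zeroᵗ
    (sucᵗ (fstᵗ ∘ᵗ sndᵗ) +ᵗ sndᵗ ∘ᵗ sndᵗ) (λ _ → refl) (λ _ _ → refl)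

unpairᵗ : ∀ {f} → Total Γ nat f → Total Γ (nat ⊗ nat) (λ γ → unpair (f γ))
unpairᵗ = natrecᵗ (λ _ → unpair) (zeroᵗ ,ᵗ zeroᵗ) (nextᵗ ∘ᵗ sndᵗ ∘ᵗ sndᵗ)
  (λ _ → refl) (λ _ _ → refl)
  where
  nextᵗ : Total (nat ⊗ nat) (nat ⊗ nat) next
  nextᵗ = natrecᵗ (λ (_ , j) i → next (i , j))
    (sucᵗ sndᵗ ,ᵗ zeroᵗ) (fstᵗ ∘ᵗ sndᵗ ,ᵗ sucᵗ (sndᵗ ∘ᵗ fstᵗ))
    (λ _ → refl) (λ _ _ → refl) fstᵗ

lengthᵗ : ∀ {f} → Total Γ (list τ) f → Total Γ nat (λ γ → length (f γ))
lengthᵗ = listrecᵗ (λ _ → length) zeroᵗ (sucᵗ (sndᵗ ∘ᵗ sndᵗ ∘ᵗ sndᵗ))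
  (λ _ → refl) (λ _ _ _ → refl)

_∷ʳᵗ_ : ∀ {f g} → Total Γ (list τ) f → Total Γ τ g →
        Total Γ (list τ) (λ γ → f γ ∷ʳ g γ)
_∷ʳᵗ_ {g = g} φ ψ = listrecᵗ (λ γ as → as ∷ʳ g γ) (consᵗ ψ nilᵗ)
  (consᵗ (fstᵗ ∘ᵗ sndᵗ) (sndᵗ ∘ᵗ sndᵗ ∘ᵗ sndᵗ)) (λ _ → refl) (λ _ _ _ → refl) φ

codeWordᵗ : ∀ {f} → Total Γ (list nat) f → Total Γ nat (λ γ → codeWord (f γ))
codeWordᵗ = listrecᵗ (λ _ → codeWord) zeroᵗ
  (sucᵗ (pairᵗ (fstᵗ ∘ᵗ sndᵗ) (sndᵗ ∘ᵗ sndᵗ ∘ᵗ sndᵗ))) (λ _ → refl) (λ _ _ _ → refl)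

at : A → List A → ℕ → A
at d []       i       = d
at d (a ∷ as) zero    = a
at d (a ∷ as) (suc i) = at d as i

-- List recursion runs from the end of the list and cannot consume an index on the way. So `drop 1`
-- is iterated first, and the head is taken afterwards.
atᵗ : ∀ {d : ⟦ τ ⟧} {f n} → Total Γ τ (λ _ → d) → Total Γ (list τ) f → Total Γ nat n →
      Total Γ τ (λ γ → at d (f γ) (n γ))
atᵗ {τ} {Γ} {d} {f} {n} δ φ ν = Total-ext (λ γ → head-drop (f γ) (n γ))
  (listrecᵗ (λ _ → head) δ (fstᵗ ∘ᵗ sndᵗ) (λ _ → refl) (λ _ _ _ → refl)
    (natrecᵗ (λ γ n → drop n (f γ)) φ
      (listrecᵗ (λ _ → drop 1) nilᵗ (fstᵗ ∘ᵗ sndᵗ ∘ᵗ sndᵗ) (λ _ → refl) (λ _ _ _ → refl)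
        (sndᵗ ∘ᵗ sndᵗ))
      (λ _ → refl) (λ γ n → drop-suc n (f γ)) ν))
  where
  head : List ⟦ τ ⟧ → ⟦ τ ⟧
  head as = at d as 0

  head-drop : ∀ as i → head (drop i as) ≡ at d as i
  head-drop []       zero    = refl
  head-drop []       (suc i) = refl
  head-drop (a ∷ as) zero    = refl
  head-drop (a ∷ as) (suc i) = head-drop as i

  drop-suc : ∀ i (as : List ⟦ τ ⟧) → drop (suc i) as ≡ drop 1 (drop i as)
  drop-suc zero    as       = refl
  drop-suc (suc i) []       = refl
  drop-suc (suc i) (a ∷ as) = drop-suc i as

applyUpToᵗ : ∀ {f : ⟦ Γ ⊗ nat ⟧ → ⟦ τ ⟧} {n} → Total (Γ ⊗ nat) τ f → Total Γ nat n →
             Total Γ (list τ) (λ γ → applyUpTo (λ i → f (γ , i)) (n γ))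
applyUpToᵗ {f = f} φ =
  natrecᵗ (λ γ → applyUpTo (λ i → f (γ , i))) nilᵗ
    ((sndᵗ ∘ᵗ sndᵗ) ∷ʳᵗ (φ ∘ᵗ (fstᵗ ,ᵗ fstᵗ ∘ᵗ sndᵗ)))
    (λ _ → refl) (λ γ n → sym (applyUpTo-∷ʳ (λ i → f (γ , i)) n))

at-applyUpTo : ∀ (d : A) f {n i} → i < n → at d (applyUpTo f n) i ≡ f i
at-applyUpTo d f {suc n} {zero}  _         = refl
at-applyUpTo d f {suc n} {suc i} (s≤s i<n) = at-applyUpTo d (f ∘ suc) i<n

-- Course-of-values recursion: `b` sees the list of all earlier values.

module CourseOfValues (b : List A → ℕ → A) where
  private
    table : ℕ → List A
    table zero    = []
    table (suc n) = table n ∷ʳ b (table n) n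

  abstract
    value : ℕ → A
    value n = b (table n) n

    value-unfold : ∀ n → value n ≡ b (applyUpTo value n) n
    value-unfold n = cong (λ t → b t n) (table-values n)
      where
      table-values : ∀ n → table n ≡ applyUpTo value n
      table-values zero    = refl
      table-values (suc n) =
        trans (cong (_∷ʳ value n) (table-values n)) (applyUpTo-∷ʳ value n)

module _ {b : ⟦ list τ ⟧ → ℕ → ⟦ τ ⟧} where
  open CourseOfValues b

  valueᵗ : ∀ {n} → Total (list τ ⊗ nat) τ (λ (t , n) → b t n) → Total Γ nat n →
           Total Γ τ (λ γ → value (n γ))
  valueᵗ {n = n} β ν = Total-ext (λ γ → sym (value-unfold (n γ)))
    (β ∘ᵗ (natrecᵗ (λ _ → applyUpTo value) nilᵗ
              ((sndᵗ ∘ᵗ sndᵗ) ∷ʳᵗ (β ∘ᵗ (sndᵗ ∘ᵗ sndᵗ ,ᵗ fstᵗ ∘ᵗ sndᵗ)))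
              (λ _ → refl)
              (λ _ k → trans (sym (applyUpTo-∷ʳ value k))
                          (cong (applyUpTo value k ∷ʳ_) (value-unfold k)))
              ν
          ,ᵗ ν))

-- Bounds for pairing, and the decoding of words.

m≤triangle : ∀ m → m ≤ triangle m
m≤triangle zero    = z≤n
m≤triangle (suc m) = m≤m+n (suc m) (triangle m)

m+m≤1+triangle : ∀ m → m + m ≤ suc (triangle m)
m+m≤1+triangle zero    = z≤n
m+m≤1+triangle (suc m) rewrite +-suc m m =
  s≤s (s≤s (+-monoʳ-≤ m (m≤triangle m)))

triangle-mono : ∀ {m n} → m ≤ n → triangle m ≤ triangle n
triangle-mono z≤n       = z≤n
triangle-mono (s≤s m≤n) = +-mono-≤ (s≤s m≤n) (triangle-mono m≤n)

i≤pair : ∀ i j → i ≤ pair i j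
i≤pair i j = ≤-trans (m≤m+n i j) (≤-trans (m≤triangle (i + j)) (m≤m+n _ j))

j≤pair : ∀ i j → j ≤ pair i j
j≤pair i j = m≤n+m j (triangle (i + j))

pair-next : ∀ i j → pair (proj₁ (next (i , j))) (proj₂ (next (i , j))) ≡ suc (pair i j)
pair-next zero j
  rewrite +-identityʳ j | +-identityʳ (triangle (suc j)) = cong suc (+-comm j (triangle j))
pair-next (suc i) j rewrite +-suc i j = +-suc (triangle (suc i + j)) j

pair-unpair : ∀ n → pair (proj₁ (unpair n)) (proj₂ (unpair n)) ≡ n
pair-unpair zero    = refl
pair-unpair (suc n) = trans (pair-next (proj₁ (unpair n)) (proj₂ (unpair n)))
  (cong suc (pair-unpair n))

proj₂-unpair≤ : ∀ n → proj₂ (unpair n) ≤ n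
proj₂-unpair≤ n =
  ≤-trans (j≤pair (proj₁ (unpair n)) _) (≤-reflexive (pair-unpair n))

entry-injective : ∀ i j i′ j′ → 3 + pair i j ≡ 3 + pair i′ j′ → i ≡ i′ × j ≡ j′
entry-injective i j i′ j′ e = cong proj₁ e′ , cong proj₂ e′
  where
  e′ : (i , j) ≡ (i′ , j′)
  e′ = trans (sym (unpair-pair i j))
         (trans (cong (unpair ∘ (_∸ 3)) e) (unpair-pair i′ j′))

private
  -- The inverse of `codeWord`. The tail of a word has a smaller code than the word, so it is found
  -- in the table.
  decodeStep : List Word → ℕ → Word
  decodeStep t = natCase [] (λ m → proj₁ (unpair m) ∷ at [] t (proj₂ (unpair m)))

open CourseOfValues decodeStep
  renaming (value to decodeWord; value-unfold to decodeWord-unfold) using ()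

decodeWord-suc : ∀ m →
  decodeWord (suc m) ≡ proj₁ (unpair m) ∷ decodeWord (proj₂ (unpair m))
decodeWord-suc m = trans (decodeWord-unfold (suc m))
  (cong (proj₁ (unpair m) ∷_) (at-applyUpTo [] decodeWord (s≤s (proj₂-unpair≤ m))))

decodeWord-codeWord : ∀ w → decodeWord (codeWord w) ≡ w
decodeWord-codeWord []      = decodeWord-unfold 0
decodeWord-codeWord (n ∷ w) = trans (decodeWord-suc (pair n (codeWord w)))
  (trans (cong (λ (i , j) → i ∷ decodeWord j) (unpair-pair n (codeWord w)))
    (cong (n ∷_) (decodeWord-codeWord w)))

codeWord-injective : ∀ {u v} → codeWord u ≡ codeWord v → u ≡ v
codeWord-injective {u} {v} e =
  trans (sym (decodeWord-codeWord u)) (trans (cong decodeWord e) (decodeWord-codeWord v))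

codeWord-decodeWord : ∀ n → codeWord (decodeWord n) ≡ n
codeWord-decodeWord n = go n ≤-refl
  where
  -- The recursion descends to the second component of `unpair n`, not to a predecessor, hence the
  -- induction on a bound.
  go : ∀ {n} m → n ≤ m → codeWord (decodeWord n) ≡ n
  go {zero}  m       _         = cong codeWord (decodeWord-unfold 0)
  go {suc n} (suc m) (s≤s n≤m) rewrite decodeWord-suc n =
    cong suc (trans
      (cong (pair (proj₁ (unpair n))) (go m (≤-trans (proj₂-unpair≤ n) n≤m)))
      (pair-unpair n))

length≤codeWord : ∀ w → length w ≤ codeWord w
length≤codeWord []      = z≤n
length≤codeWord (n ∷ w) = s≤s (≤-trans (length≤codeWord w) (j≤pair n (codeWord w)))

length-decodeWord : ∀ n → length (decodeWord n) ≤ n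
length-decodeWord n =
  ≤-trans (length≤codeWord (decodeWord n)) (≤-reflexive (codeWord-decodeWord n))

-- This is why the self-reference of the translation ends: a word mentioned by an entry contained in
-- `w` has a smaller code than `w`.
at≤codeWord : ∀ w i → at 0 w i ≤ codeWord w
at≤codeWord []      i       = z≤n
at≤codeWord (n ∷ w) zero    = m≤n⇒m≤1+n (i≤pair n (codeWord w))
at≤codeWord (n ∷ w) (suc i) =
  m≤n⇒m≤1+n (≤-trans (at≤codeWord w i) (j≤pair n (codeWord w)))

decodeWordᵗ : ∀ {f} → Total Γ nat f → Total Γ (list nat) (λ γ → decodeWord (f γ))
decodeWordᵗ = valueᵗ
  (natCaseᵗ nilᵗ (consᵗ (fstᵗ ∘ᵗ unpairᵗ sndᵗ)
                        (atᵗ nilᵗ (fstᵗ ∘ᵗ fstᵗ) (sndᵗ ∘ᵗ unpairᵗ sndᵗ))) sndᵗ)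

-- Words as prefixes of points

infix 5 _↾_

-- Extends a word by zeros, so that functionals on points apply to words. Only the positions below
-- the length carry information.
get : Word → Baire
get = at 0

_↾_ : Baire → ℕ → Word
p ↾ n = applyUpTo p n

Agree : ℕ → Baire → Baire → Set
Agree n p q = ∀ {i} → i < n → p i ≡ q i

Image : (Word → Word) → Baire → Word → Set
Image φ p v = ∃[ w ] w ≺ p × v ≡ φ w

≺⇒Agree : ∀ w {p} → w ≺ p → Agree (length w) (get w) p
≺⇒Agree (a ∷ w) w≺p {zero}  _         = w≺p zero
≺⇒Agree (a ∷ w) w≺p {suc i} (s≤s i<n) = ≺⇒Agree w (w≺p ∘ suc) i<n

Agree⇒≺ : ∀ w {p} → Agree (length w) (get w) p → w ≺ p
Agree⇒≺ (a ∷ w) e zero    = e z<s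
Agree⇒≺ (a ∷ w) {p} e (suc i) = Agree⇒≺ w {p ∘ suc} (λ j<n → e (s<s j<n)) i

⊑⇒≤ : ∀ {u v} → u ⊑ v → length u ≤ length v
⊑⇒≤ []      = z≤n
⊑⇒≤ (_ ∷ l) = s≤s (⊑⇒≤ l)

⊑⇒Agree : ∀ {u v} → u ⊑ v → Agree (length u) (get u) (get v)
⊑⇒Agree (e ∷ l) {zero}  _         = e
⊑⇒Agree (e ∷ l) {suc i} (s≤s i<n) = ⊑⇒Agree l i<n

Agree⇒⊑ : ∀ {u v} → length u ≤ length v → Agree (length u) (get u) (get v) → u ⊑ v
Agree⇒⊑ {[]}            _         e = []
Agree⇒⊑ {a ∷ u} {b ∷ v} (s≤s l) e = e z<s ∷ Agree⇒⊑ l (λ i<n → e (s<s i<n))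

⊑-≺-trans : ∀ {u v p} → u ⊑ v → v ≺ p → u ≺ p
⊑-≺-trans {u} {v} {p} u⊑v v≺p = Agree⇒≺ u {p} λ i<n →
  trans (⊑⇒Agree u⊑v i<n) (≺⇒Agree v {p} v≺p (<-≤-trans i<n (⊑⇒≤ u⊑v)))

≺-directed : ∀ {u v p} → u ≺ p → v ≺ p → length u ≤ length v → u ⊑ v
≺-directed {u} {v} {p} u≺p v≺p u≤v = Agree⇒⊑ u≤v λ i<n →
  trans (≺⇒Agree u {p} u≺p i<n) (sym (≺⇒Agree v {p} v≺p (<-≤-trans i<n u≤v)))

length-↾ : ∀ p n → length (p ↾ n) ≡ n
length-↾ = length-applyUpTo

↾-≺ : ∀ {p q} n → Agree n p q → p ↾ n ≺ q
↾-≺ (suc n) e zero    = e z<s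
↾-≺ {q = q} (suc n) e (suc i) = ↾-≺ {q = q ∘ suc} n (λ j<n → e (s<s j<n)) i

↾-mono : ∀ {m n p q} → m ≤ n → Agree m p q → p ↾ m ⊑ q ↾ n
↾-mono z≤n     e = []
↾-mono (s≤s l) e = e z<s ∷ ↾-mono l (λ i<n → e (s<s i<n))

↾-cong : ∀ n {p q} → Agree n p q → p ↾ n ≡ q ↾ n
↾-cong zero    e = refl
↾-cong (suc n) e = cong₂ _∷_ (e z<s) (↾-cong n (λ i<n → e (s<s i<n)))

≺⇒↾ : ∀ w {p} → w ≺ p → p ↾ length w ≡ w
≺⇒↾ []      _   = refl
≺⇒↾ (a ∷ w) {p} w≺p = cong₂ _∷_ (sym (w≺p zero)) (≺⇒↾ w {p ∘ suc} (w≺p ∘ suc))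

-- Pairing of points

first second : Baire → Baire
first  x j = x (j + j)
second x j = x (suc (j + j))

first-⟪⟫ : ∀ q p → first ⟪ q , p ⟫ ≗ q
first-⟪⟫ q p zero    = refl
first-⟪⟫ q p (suc j) rewrite +-suc j j = first-⟪⟫ (q ∘ suc) (p ∘ suc) j

second-⟪⟫ : ∀ q p → second ⟪ q , p ⟫ ≗ p
second-⟪⟫ q p = first-⟪⟫ p (q ∘ suc)

⟪first,second⟫ : ∀ x → ⟪ first x , second x ⟫ ≗ x
⟪first,second⟫ x zero    = refl
⟪first,second⟫ x (suc n) = trans
  (⟪⟫-cong {p = first x ∘ suc} {second (x ∘ suc)} (λ _ → refl)
    (λ j → cong (x ∘ suc) (+-suc j j)) n)
  (⟪first,second⟫ (x ∘ suc) n)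

⟪⟫-Agree : ∀ n {q q′ p p′} → Agree n q q′ → Agree n p p′ →
           Agree (n + n) ⟪ q , p ⟫ ⟪ q′ , p′ ⟫
⟪⟫-Agree (suc n) e e′ {zero}        _   = e z<s
⟪⟫-Agree (suc n) e e′ {suc zero}    _   = e′ z<s
⟪⟫-Agree (suc n) e e′ {suc (suc i)} i<n rewrite +-suc n n =
  ⟪⟫-Agree n (λ j<n → e (s<s j<n)) (λ j<n → e′ (s<s j<n)) (s<s⁻¹ (s<s⁻¹ i<n))

-- The tupling swaps and shifts its arguments as it recurses. Appending digit `n` of `q` and of `p`
-- at the end keeps both fixed.
⟪⟫↾ᵗ : ∀ {q p : ⟦ Γ ⊗ nat ⟧ → ℕ} {n} →
       Total (Γ ⊗ nat) nat q → Total (Γ ⊗ nat) nat p → Total Γ nat n →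
       Total Γ (list nat)
         (λ γ → ⟪ (λ i → q (γ , i)) , (λ i → p (γ , i)) ⟫ ↾ (n γ + n γ))
⟪⟫↾ᵗ {Γ} {q} {p} κ π = natrecᵗ (λ γ n → ⟪ q′ γ , p′ γ ⟫ ↾ (n + n)) nilᵗ
  (((sndᵗ ∘ᵗ sndᵗ) ∷ʳᵗ (κ ∘ᵗ (fstᵗ ,ᵗ fstᵗ ∘ᵗ sndᵗ))) ∷ʳᵗ (π ∘ᵗ (fstᵗ ,ᵗ fstᵗ ∘ᵗ sndᵗ)))
  (λ _ → refl) unfold
  where
  q′ p′ : ⟦ Γ ⟧ → Baire
  q′ γ i = q (γ , i)
  p′ γ i = p (γ , i)

  unfold : ∀ γ n → ⟪ q′ γ , p′ γ ⟫ ↾ (suc n + suc n) ≡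
           ((⟪ q′ γ , p′ γ ⟫ ↾ (n + n)) ∷ʳ q′ γ n) ∷ʳ p′ γ n
  unfold γ n rewrite +-suc n n
    | sym (first-⟪⟫ (q′ γ) (p′ γ) n) | sym (second-⟪⟫ (q′ γ) (p′ γ) n) = sym (trans
      (cong (_∷ʳ ⟪ p′ γ , q′ γ ∘ suc ⟫ (n + n)) (applyUpTo-∷ʳ ⟪ q′ γ , p′ γ ⟫ (n + n)))
      (applyUpTo-∷ʳ ⟪ q′ γ , p′ γ ⟫ (suc (n + n))))

-- Functionals with a modulus

-- The number of output digits printed from an input of length ℓ, when digit `n` needs `β n` input
-- digits. Each step prints at most one digit, and only if its needs are met; the subtraction
-- vanishes exactly then.
reach : (ℕ → ℕ) → ℕ → ℕ
reach β zero    = 0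
reach β (suc ℓ) =
  natCase (suc (reach β ℓ)) (λ _ → reach β ℓ) (β (reach β ℓ) ∸ suc ℓ)

reachᵗ : ∀ {β n} → Total nat nat β → Total Γ nat n → Total Γ nat (λ γ → reach β (n γ))
reachᵗ {β = β} b = natrecᵗ (λ _ → reach β) zeroᵗ
  (natCaseᵗ (sucᵗ (sndᵗ ∘ᵗ sndᵗ)) (sndᵗ ∘ᵗ sndᵗ ∘ᵗ fstᵗ)
    (b ∘ᵗ sndᵗ ∘ᵗ sndᵗ ∸ᵗ sucᵗ (fstᵗ ∘ᵗ sndᵗ)))
  (λ _ → refl) (λ _ _ → refl)

module _ (β : ℕ → ℕ) where

  reach-bound : ∀ ℓ {n} → n < reach β ℓ → β n ≤ ℓ
  reach-bound (suc ℓ) {n} n< with β (reach β ℓ) ∸ suc ℓ in eq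
  ... | suc _ = m≤n⇒m≤1+n (reach-bound ℓ n<)
  ... | zero with m<1+n⇒m<n∨m≡n n<
  ...   | inj₁ n<r  = m≤n⇒m≤1+n (reach-bound ℓ n<r)
  ...   | inj₂ refl = m∸n≡0⇒m≤n eq

  reach-suc : ∀ ℓ → reach β ℓ ≤ reach β (suc ℓ)
  reach-suc ℓ with β (reach β ℓ) ∸ suc ℓ
  ... | suc _ = ≤-refl
  ... | zero  = n≤1+n _

  reach-mono : ∀ {k ℓ} → k ≤ ℓ → reach β k ≤ reach β ℓ
  reach-mono k≤ℓ = go (≤⇒≤′ k≤ℓ)
    where
    go : ∀ {k ℓ} → k ≤′ ℓ → reach β k ≤ reach β ℓ
    go ≤′-refl            = ≤-refl
    go (≤′-step {ℓ} k≤ℓ) = ≤-trans (go k≤ℓ) (reach-suc ℓ)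

  -- If no more than `n` digits are printed at length `ℓ + β n`, then the next step prints digit
  -- `n`, as everything it needs is present.
  reach-unbounded : ∀ n → ∃[ ℓ ] n ≤ reach β ℓ
  reach-unbounded zero    = 0 , z≤n
  reach-unbounded (suc n) with reach-unbounded n
  ... | ℓ , n≤r with m≤n⇒m<n∨m≡n (≤-trans n≤r (reach-mono (m≤m+n ℓ (β n))))
  ...   | inj₁ n<r = ℓ + β n , n<r
  ...   | inj₂ n≡r = suc (ℓ + β n) , (begin
      suc n                        ≡⟨ cong suc n≡r ⟩
      suc r                        ≡⟨ cong (natCase (suc r) (λ _ → r)) enough ⟨
      reach β (suc (ℓ + β n))      ∎)
    where
    open ≤-Reasoning
    r = reach β (ℓ + β n)
    enough : β r ∸ suc (ℓ + β n) ≡ 0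
    enough = m≤n⇒m∸n≡0 (m≤n⇒m≤1+n
      (subst (λ k → β k ≤ ℓ + β n) n≡r (m≤n+m (β n) ℓ)))

record Modulus (D : Baire → Baire) (β : ℕ → ℕ) : Set where
  constructor modulus
  field local : ∀ {x x′} n → Agree (β n) x x′ → D x n ≡ D x′ n

module Reader {D β} (m : Modulus D β) where
  open Modulus m

  -- The zeros added by `get` have no influence: only digits whose needs are met by `w` itself are
  -- printed.
  read : Word → Word
  read w = D (get w) ↾ reach β (length w)

  readᵗ : ∀ {w} → Total (list nat ⊗ nat) nat (λ (w , n) → D (get w) n) →
          Total nat nat β → Total Γ (list nat) w →
          Total Γ (list nat) (λ γ → read (w γ))
  readᵗ d b ω = applyUpToᵗ (d ∘ᵗ (ω ∘ᵗ fstᵗ ,ᵗ sndᵗ)) (reachᵗ b (lengthᵗ ω))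

  read-mono : Monotone read
  read-mono {u} u⊑v = ↾-mono (reach-mono β (⊑⇒≤ u⊑v)) λ {n} n<r →
    local n λ i<β → ⊑⇒Agree u⊑v (<-≤-trans i<β (reach-bound β (length u) n<r))

  read-≺ : ∀ {w x} → w ≺ x → read w ≺ D x
  read-≺ {w} {x} w≺x = ↾-≺ (reach β (length w)) λ {n} n<r →
    local n λ i<β → ≺⇒Agree w {x} w≺x (<-≤-trans i<β (reach-bound β (length w) n<r))

  read-unbounded : ∀ n → ∃[ ℓ ] (∀ {w} → ℓ ≤ length w → n ≤ length (read w))
  read-unbounded n with reach-unbounded β n
  ... | ℓ , n≤r = ℓ , λ {w} ℓ≤w → ≤-trans (≤-trans n≤r (reach-mono β ℓ≤w))
    (≤-reflexive (sym (length-↾ (D (get w)) _)))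

  read-sup : ∀ x → IsSup (Image read x) (D x)
  read-sup x = record
    { upper     = λ { (w , w≺x , refl) → read-≺ {w} {x} w≺x }
    ; unbounded = λ n → let ℓ , large = read-unbounded n in
        read (x ↾ ℓ) , (x ↾ ℓ , ↾-≺ {x} ℓ (λ _ → refl) , refl)
      , large {x ↾ ℓ} (≤-reflexive (sym (length-↾ x ℓ)))
    }

second-modulus : Modulus second (λ n → suc (suc (n + n)))
second-modulus = modulus λ n e → e ≤-refl

-- The translation of words and of states.

module Translation
  {φH φK : Word → Word} (Hᵗ : Total (list nat) (list nat) φH)
  (Kᵗ : Total (list nat) (list nat) φK)
  (φH-mono : Monotone φH) (φK-mono : Monotone φK) where

  open Reader second-modulus using ()
    renaming (read to oddWord; readᵗ to oddWordᵗ; read-mono to oddWord-mono;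
              read-≺ to oddWord-≺; read-unbounded to oddWord-unbounded)

  -- What is known of H ⟪ p , r ⟫ when p is the second half of `x` and `a` is the code of a prefix
  -- of the answer r.
  hWord : Baire → ℕ → Word
  hWord x a = φH (⟪ second x , get u ⟫ ↾ (length u + length u))
    where u = decodeWord a

  kWord : Word → Word
  kWord w = φK (oddWord w)

  -- Digit `n` of `S x` depends on the first `n + 1` digits of `x`, so `w` determines `length w`
  -- digits of it. The minimum allows both halves to be interleaved evenly.
  size : Word → ℕ
  size w = length w ⊓ length (kWord w)

  -- This is 0 if and only if c is the code of a prefix of h.
  mismatch : Word → ℕ → ℕ
  mismatch h c = (c′ ∸ c) + (c ∸ c′)
    where c′ = codeWord (get h ↾ (length (decodeWord c) ⊓ length h))

  -- An entry of q that applies to the known part of H ⟪ p , r ⟫ is passed on with its value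
  -- translated; any other is replaced by a dummy. The parameter `T` stands for a finite table on
  -- words and for the finished translation on points.
  transcribe : (ℕ → Word) → Baire → ℕ → ℕ × ℕ → ℕ
  transcribe T x a (c , d) =
    natCase (3 + pair a (codeWord (T d))) (λ _ → 0) (mismatch (hWord x a) c)

  -- The digits with index (0 , k) are pairs (u , []), which do not affect Φ, and
  -- store x.  The digit with index (suc a , k) is for the word u with code a
  -- and for digit k of the name q in x = ⟪ q , p ⟫; subtracting 2 from the
  -- latter identifies the dummies.
  digit : (ℕ → Word) → Baire → ℕ × ℕ → ℕ
  digit T x (i , k) =
    natCase (3 + pair (codeWord (x k ∷ [])) 0)
      (λ a → natCase 0 (λ e → transcribe T x a (unpair e)) (x (k + k) ∸ 2)) i

  translateStep : (ℕ → Word) → Word → Word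
  translateStep T w =
    ⟪ (λ n → digit T (get w) (unpair n)) , get (kWord w) ⟫ ↾ (size w + size w)

  open CourseOfValues (λ t c → translateStep (at [] t) (decodeWord c))
    using (value; value-unfold)

  abstract
    translate : Word → Word
    translate w = value (codeWord w)

    S : Baire → Baire
    S x n = digit value x (unpair n)

    S-stores : ∀ x j → S x (pair 0 j) ≡ 3 + pair (codeWord (x j ∷ [])) 0
    S-stores x j = cong (digit value x) (unpair-pair 0 j)

  transcribeᵗ : ∀ {t w a e} →
    Total Γ (list (list nat)) t → Total Γ (list nat) w →
    Total Γ nat a → Total Γ (nat ⊗ nat) e →
    Total Γ nat (λ γ → transcribe (at [] (t γ)) (get (w γ)) (a γ) (e γ))
  transcribeᵗ {Γ} {t} {w} {a} θ ω α ε = natCaseᵗ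
    (sucᵗ (sucᵗ (sucᵗ (pairᵗ α (codeWordᵗ (atᵗ nilᵗ θ (sndᵗ ∘ᵗ ε)))))))
    zeroᵗ
    (mismatchᵗ hWordᵗ (fstᵗ ∘ᵗ ε))
    where
    mismatchᵗ : ∀ {h c} → Total Γ (list nat) h → Total Γ nat c →
                Total Γ nat (λ γ → mismatch (h γ) (c γ))
    mismatchᵗ {h} η ς = (κ ∸ᵗ ς) +ᵗ (ς ∸ᵗ κ)
      where κ = codeWordᵗ (applyUpToᵗ (atᵗ zeroᵗ (η ∘ᵗ fstᵗ) sndᵗ)
                            (lengthᵗ (decodeWordᵗ ς) ⊓ᵗ lengthᵗ η))

    hWordᵗ : Total Γ (list nat) (λ γ → hWord (get (w γ)) (a γ))
    hWordᵗ = Hᵗ ∘ᵗ ⟪⟫↾ᵗ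
      (atᵗ zeroᵗ (ω ∘ᵗ fstᵗ) (sucᵗ (sndᵗ +ᵗ sndᵗ)))
      (atᵗ zeroᵗ (decodeWordᵗ α ∘ᵗ fstᵗ) sndᵗ)
      (lengthᵗ (decodeWordᵗ α))

  digitᵗ : ∀ {t w n} →
    Total Γ (list (list nat)) t → Total Γ (list nat) w → Total Γ (nat ⊗ nat) n →
    Total Γ nat (λ γ → digit (at [] (t γ)) (get (w γ)) (n γ))
  digitᵗ θ ω ν = natCaseᵗ
    (sucᵗ (sucᵗ (sucᵗ
      (pairᵗ (codeWordᵗ (consᵗ (atᵗ zeroᵗ ω (sndᵗ ∘ᵗ ν)) nilᵗ)) zeroᵗ))))
    (natCaseᵗ zeroᵗ
      (transcribeᵗ (θ ∘ᵗ fstᵗ ∘ᵗ fstᵗ) (ω ∘ᵗ fstᵗ ∘ᵗ fstᵗ) (sndᵗ ∘ᵗ fstᵗ) (unpairᵗ sndᵗ))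
      (atᵗ zeroᵗ (ω ∘ᵗ fstᵗ) (sndᵗ ∘ᵗ ν ∘ᵗ fstᵗ +ᵗ sndᵗ ∘ᵗ ν ∘ᵗ fstᵗ) ∸ᵗ sucᵗ (sucᵗ zeroᵗ)))
    (fstᵗ ∘ᵗ ν)

  abstract
    translateᵗ : Total (list nat) (list nat) translate
    translateᵗ = valueᵗ
      (⟪⟫↾ᵗ (digitᵗ (fstᵗ ∘ᵗ fstᵗ) (ω ∘ᵗ fstᵗ) (unpairᵗ sndᵗ))
            (atᵗ zeroᵗ (kWordᵗ ∘ᵗ fstᵗ) sndᵗ)
            (lengthᵗ ω ⊓ᵗ lengthᵗ kWordᵗ))
      (codeWordᵗ idᵗ)
      where
      ω : Total (list (list nat) ⊗ nat) (list nat) (λ (_ , c) → decodeWord c)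
      ω = decodeWordᵗ sndᵗ
      kWordᵗ : Total (list (list nat) ⊗ nat) (list nat) (λ (_ , c) → kWord (decodeWord c))
      kWordᵗ = Kᵗ ∘ᵗ oddWordᵗ (atᵗ zeroᵗ fstᵗ (sucᵗ (sndᵗ +ᵗ sndᵗ)))
                       (sucᵗ (sucᵗ (idᵗ +ᵗ idᵗ))) ω

  -- Entries in `w` mention only words with smaller codes than `w`, so the table of the values below
  -- that code suffices.
  digit-table : ∀ w i → digit (at [] (applyUpTo value (codeWord w))) (get w) i ≡
                        digit value (get w) i
  digit-table w (zero  , k) = refl
  digit-table w (suc a , k) with get w (k + k) ∸ 2 in eq
  ... | zero  = refl
  ... | suc e = cong
    (λ v → natCase (3 + pair a (codeWord v)) (λ _ → 0)
             (mismatch (hWord (get w) a) (proj₁ (unpair e))))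
    (at-applyUpTo [] value (begin-strict
      proj₂ (unpair e)     ≤⟨ proj₂-unpair≤ e ⟩
      e                    <⟨ n<1+n e ⟩
      suc e                ≡⟨ eq ⟨
      get w (k + k) ∸ 2    ≤⟨ m∸n≤m _ 2 ⟩
      get w (k + k)        ≤⟨ at≤codeWord w (k + k) ⟩
      codeWord w           ∎))
    where open ≤-Reasoning

  abstract
    translate-unfold : ∀ w →
      translate w ≡ ⟪ S (get w) , get (kWord w) ⟫ ↾ (size w + size w)
    translate-unfold w = begin
      value (codeWord w)                                            ≡⟨ value-unfold _ ⟩
      translateStep (at [] t) (decodeWord (codeWord w))
        ≡⟨ cong (translateStep (at [] t)) (decodeWord-codeWord w) ⟩
      translateStep (at [] t) w
        ≡⟨ ↾-cong (size w + size w) (λ {i} _ → ⟪⟫-cong {p = get (kWord w)}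
             (λ n → digit-table w (unpair n)) (λ _ → refl) i) ⟩
      translateStep value w                                         ∎
      where
      open ≡-Reasoning
      t : List Word
      t = applyUpTo value (codeWord w)

  -- The word with code `a` has at most `a` digits, so only positions of `x` below `a + a` are read.
  -- The triangular number in `pair (suc a) k` leaves room for them.
  hWord-local : ∀ {x x′} a k → Agree (suc (pair (suc a) k)) x x′ → hWord x a ≡ hWord x′ a
  hWord-local a k e = cong φH (↾-cong (ℓ + ℓ) (⟪⟫-Agree ℓ
      (λ {j} j<ℓ → e (s≤s (bound j (<-≤-trans j<ℓ (length-decodeWord a)))))
      (λ _ → refl)))
    where
    open ≤-Reasoning
    ℓ = length (decodeWord a)
    bound : ∀ j → j < a → suc (j + j) ≤ pair (suc a) k
    bound j j<a = s≤s⁻¹ (begin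
      suc (suc (j + j))              ≡⟨ cong suc (+-suc j j) ⟨
      suc j + suc j                  ≤⟨ +-mono-≤ j<a j<a ⟩
      a + a                          ≤⟨ m+m≤1+triangle a ⟩
      suc (triangle a)
        ≤⟨ s≤s (triangle-mono (≤-trans (n≤1+n a) (m≤m+n (suc a) k))) ⟩
      suc (triangle (suc a + k))     ≤⟨ s≤s (m≤m+n _ k) ⟩
      suc (pair (suc a) k)           ∎)

  digit-local : ∀ {x x′} i k → Agree (suc (pair i k)) x x′ →
                digit value x (i , k) ≡ digit value x′ (i , k)
  digit-local zero    k e =
    cong (λ d → 3 + pair (codeWord (d ∷ [])) 0) (e (s≤s (j≤pair 0 k)))
  digit-local {x} {x′} (suc a) k e
    rewrite e {k + k} (s≤s (+-monoˡ-≤ k (≤-trans (m≤n+m k (suc a)) (m≤triangle (suc a + k)))))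
          | hWord-local a k e = refl

  abstract
    S-local : ∀ {x x′} n → Agree (suc n) x x′ → S x n ≡ S x′ n
    S-local n e = digit-local (proj₁ (unpair n)) (proj₂ (unpair n)) λ i< →
      e (<-≤-trans i< (s≤s (≤-reflexive (pair-unpair n))))

  S-cong : ∀ {x x′} → x ≗ x′ → S x ≗ S x′
  S-cong x≗x′ n = S-local n λ {i} _ → x≗x′ i

  kWord-mono : Monotone kWord
  kWord-mono = φK-mono ∘ oddWord-mono

  translate-mono : Monotone translate
  translate-mono {u} {v} u⊑v rewrite translate-unfold u | translate-unfold v =
    ↾-mono (+-mono-≤ sizes sizes) (⟪⟫-Agree (size u)
      (λ {i} i<m → S-local i λ j≤i →
        ⊑⇒Agree u⊑v (<-≤-trans j≤i (≤-trans i<m (m⊓n≤m (length u) _))))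
      (λ i<m → ⊑⇒Agree (kWord-mono u⊑v) (<-≤-trans i<m (m⊓n≤n (length u) _))))
    where
    sizes : size u ≤ size v
    sizes = ⊓-mono-≤ (⊑⇒≤ u⊑v) (⊑⇒≤ (kWord-mono u⊑v))

  translate-sup : ∀ {x k} → IsSup (Image φK (second x)) k →
                  IsSup (Image translate x) ⟪ S x , k ⟫
  translate-sup {x} {k} s =
    record { upper = λ { (w , w≺x , refl) → up w w≺x } ; unbounded = large }
    where
    up : ∀ w → w ≺ x → translate w ≺ ⟪ S x , k ⟫
    up w w≺x rewrite translate-unfold w = ↾-≺ (size w + size w) (⟪⟫-Agree (size w)
      (λ {i} i<m → S-local i λ j≤i →
        ≺⇒Agree w {x} w≺x (<-≤-trans j≤i (≤-trans i<m (m⊓n≤m (length w) _))))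
      (λ i<m → ≺⇒Agree (kWord w) {k}
        (upper s (oddWord w , oddWord-≺ {w} {x} w≺x , refl))
        (<-≤-trans i<m (m⊓n≤n (length w) _))))

    large : ∀ n → ∃[ v ] Image translate x v × n ≤ length v
    large n with unbounded s n
    ... | _ , (w′ , w′≺p , refl) , n≤ with oddWord-unbounded (length w′)
    ...   | ℓ , odd-large = translate w , (w , w≺x , refl) , (begin
        n                           ≤⟨ ⊓-glb n≤w n≤k ⟩
        size w                      ≤⟨ m≤m+n _ _ ⟩
        size w + size w             ≡⟨ length-↾ _ _ ⟨
        length (⟪ S (get w) , get (kWord w) ⟫ ↾ (size w + size w))
                                    ≡⟨ cong length (translate-unfold w) ⟨
        length (translate w)        ∎)
      where
      open ≤-Reasoning
      -- `n` digits serve the first half; `ℓ` digits make the odd part of `w` extend `w′`, on which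
      -- `φK` already yields `n` digits.
      w = x ↾ (ℓ + n)
      w≺x : w ≺ x
      w≺x = ↾-≺ {x} (ℓ + n) (λ _ → refl)
      n≤w : n ≤ length w
      n≤w rewrite length-↾ x (ℓ + n) = m≤n+m n ℓ
      ℓ≤w : ℓ ≤ length w
      ℓ≤w rewrite length-↾ x (ℓ + n) = m≤m+n ℓ n
      n≤k : n ≤ length (kWord w)
      n≤k = ≤-trans n≤ (⊑⇒≤ (φK-mono
        (≺-directed {p = second x} w′≺p (oddWord-≺ {w} {x} w≺x) (odd-large {w} ℓ≤w))))

  -- The meaning of the entries of `S x`.

  mismatch-sound : ∀ h c → mismatch h c ≡ 0 → ∃[ u ] codeWord u ≡ c × u ⊑ h
  mismatch-sound h c e = get h ↾ n
    , ≤-antisym (m∸n≡0⇒m≤n (m+n≡0⇒m≡0 _ e)) (m∸n≡0⇒m≤n (m+n≡0⇒n≡0 (c′ ∸ c) e))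
    , subst (get h ↾ n ⊑_) (≺⇒↾ h {get h} (Agree⇒≺ h (λ _ → refl)))
        (↾-mono (m⊓n≤n (length (decodeWord c)) _) (λ _ → refl))
    where
    n  = length (decodeWord c) ⊓ length h
    c′ = codeWord (get h ↾ n)

  mismatch-complete : ∀ {u h} → u ⊑ h → mismatch h (codeWord u) ≡ 0
  mismatch-complete {u} {h} u⊑h
    rewrite decodeWord-codeWord u | m≤n⇒m⊓n≡m (⊑⇒≤ u⊑h)
          | ≺⇒↾ u {get h} (Agree⇒≺ u (⊑⇒Agree u⊑h)) | n∸n≡0 (codeWord u) = refl

  abstract
    -- The case `d ≡ 0` covers the storing entries, whose second word is empty. Every other entry
    -- was transcribed from an entry of q, since dummies are below 3.
    digit-sound : ∀ x i k {a d} → digit value x (i , k) ≡ 3 + pair a d →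
      d ≡ 0 ⊎ (∃[ c ] ∃[ v ] x (k + k) ≡ 3 + pair c (codeWord v) ×
               mismatch (hWord x a) c ≡ 0 × d ≡ codeWord (translate v))
    digit-sound x zero    k {a} {d} e =
      inj₁ (sym (proj₂ (entry-injective (codeWord (x k ∷ [])) 0 a d e)))
    digit-sound x (suc a) k {a′} {d} e with x (k + k) in xk
    ... | suc (suc (suc m)) with mismatch (hWord x a) (proj₁ (unpair m)) in mm
    ...   | zero with entry-injective a _ a′ d e
    ...     | refl , refl = inj₂ (proj₁ (unpair m) , decodeWord (proj₂ (unpair m))
      , cong (3 +_) (trans (sym (pair-unpair m))
          (cong (pair (proj₁ (unpair m))) (sym (codeWord-decodeWord _))))
      , mm
      , cong (codeWord ∘ value) (sym (codeWord-decodeWord (proj₂ (unpair m)))))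

    digit-complete : ∀ x a k {c d} → x (k + k) ≡ 3 + pair c d → mismatch (hWord x a) c ≡ 0 →
                     digit value x (suc a , k) ≡ 3 + pair a (codeWord (value d))
    digit-complete x a k {c} {d} e mm rewrite e | unpair-pair c d | mm = refl

    -- Each transcribed entry for a prefix of `r` rests on an entry of q for a prefix of `h`, so its
    -- value is a translated prefix of `y`. Conversely, an entry of q is transcribed once the prefix
    -- of `r` is long enough for `φH` to reveal the prefix of `h` that it needs.
    S-simulates : ∀ {x r h y t} →
      IsSup (Image φH ⟪ second x , r ⟫) h → IsSup (approximations (first x) h) y →
      IsSup (Image translate y) t → IsSup (approximations (S x) r) t
    S-simulates {x} {r} {h} {y} {t} sH sU sT = record { upper = up _ ; unbounded = large }
      where
      zip : Word → Word
      zip u = ⟪ second x , get u ⟫ ↾ (length u + length u)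

      zip-≺ : ∀ u → u ≺ r → zip u ≺ ⟪ second x , r ⟫
      zip-≺ u u≺r = ↾-≺ (length u + length u)
        (⟪⟫-Agree (length u) (λ _ → refl) (≺⇒Agree u {r} u≺r))

      hWord-code : ∀ u → hWord x (codeWord u) ≡ φH (zip u)
      hWord-code u = cong (φH ∘ zip) (decodeWord-codeWord u)

      up : ∀ v → approximations (S x) r v → v ≺ t
      up v (u , u≺r , n , e)
        with digit-sound x (proj₁ (unpair n)) (proj₂ (unpair n)) {codeWord u} {codeWord v} e
      ... | inj₁ v≡[] =
        subst (_≺ t) (sym (codeWord-injective {v} {[]} v≡[])) λ ()
      ... | inj₂ (c , v′ , qk , mm , v≡)
        with mismatch-sound (hWord x (codeWord u)) c mm
      ...   | u′ , refl , u′⊑ =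
        subst (_≺ t) (sym (codeWord-injective {v} {translate v′} v≡))
          (upper sT (v′ , upper sU (u′ , u′≺h , proj₂ (unpair n) , qk) , refl))
        where
        hWord≺h : hWord x (codeWord u) ≺ h
        hWord≺h = subst (_≺ h) (sym (hWord-code u)) (upper sH (zip u , zip-≺ u u≺r , refl))
        u′≺h : u′ ≺ h
        u′≺h = ⊑-≺-trans {p = h} u′⊑ hWord≺h

      large : ∀ n → ∃[ v ] approximations (S x) r v × n ≤ length v
      -- Backwards: a prefix of `y` with a long translation, an entry of q with a value at least
      -- that long, and an input on which `φH` yields enough of `h` for this entry.
      large n with unbounded sT n
      ... | _ , (v₀ , v₀≺y , refl) , n≤ with unbounded sU (length v₀)
      ...   | v , (u′ , u′≺h , k , qk) , v₀≤v with unbounded sH (length u′)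
      ...     | _ , (w , w≺ , refl) , u′≤ =
          translate v , (u , u≺r , pair (suc (codeWord u)) k , entry)
        , ≤-trans n≤ (⊑⇒≤ (translate-mono (≺-directed {p = y} v₀≺y v≺y v₀≤v)))
        where
        v≺y : v ≺ y
        v≺y = upper sU (u′ , u′≺h , k , qk)
        u : Word
        -- With this length `zip u` extends `w`, so `φH` yields at least `length u′` digits on it.
        u = r ↾ length w
        u≺r : u ≺ r
        u≺r = ↾-≺ {r} (length w) (λ _ → refl)
        w⊑zip : w ⊑ zip u
        w⊑zip = ≺-directed {p = ⟪ second x , r ⟫} w≺ (zip-≺ u u≺r) (begin
          length w               ≡⟨ length-↾ r (length w) ⟨
          length u               ≤⟨ m≤m+n _ _ ⟩
          length u + length u    ≡⟨ length-↾ _ _ ⟨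
          length (zip u)         ∎)
          where open ≤-Reasoning
        u′⊑ : u′ ⊑ hWord x (codeWord u)
        u′⊑ rewrite hWord-code u = ≺-directed {p = h} u′≺h
          (upper sH (zip u , zip-≺ u u≺r , refl))
          (≤-trans u′≤ (⊑⇒≤ (φH-mono w⊑zip)))
        entry : S x (pair (suc (codeWord u)) k) ≡
                3 + pair (codeWord u) (codeWord (translate v))
        entry = trans (cong (digit value x) (unpair-pair (suc (codeWord u)) k))
          (digit-complete x (codeWord u) k qk (mismatch-complete u′⊑))

private module 𝔹 = Setoid 𝔹

first-≗ : ∀ {x q p} → x ≗ ⟪ q , p ⟫ → first x ≗ q
first-≗ {q = q} {p} e j = trans (e (j + j)) (first-⟪⟫ q p j)

second-≗ : ∀ {x q p} → x ≗ ⟪ q , p ⟫ → second x ≗ p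
second-≗ {q = q} {p} e j = trans (e (suc (j + j))) (second-⟪⟫ q p j)

-- Steps and runs

Φ-graph : Baire → Baire → Baire → Set
Φ-graph q p r = IsSup (approximations q p) r

-- Each point is the pair of its halves in a unique way, so a step can be described by `first` and
-- `second` instead of by unknown components.
module Step (f : 𝔹 ⇉ 𝔹) where

  private
    split : ∀ x r → graph f (second x) r → graph ⟨id× f ⟩ x ⟪ first x , r ⟫
    split x r fpr =
      first x , second x , r , 𝔹.sym (⟪first,second⟫ x) , 𝔹.refl , fpr

    U⇒Φ : ∀ {z q r y} → z ≗ ⟪ q , r ⟫ → graph (multi U) z y → Φ-graph q r y
    U⇒Φ {q = q} {r} e (q′ , r′ , e′ , s) = Φ-resp {q′} {q} {r′} {r}
      (⟪⟫-injectiveˡ e″) (⟪⟫-injectiveʳ e″) 𝔹.refl s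
      where e″ = 𝔹.trans (𝔹.sym e′) e

  step-query : ∀ {x} → x ∈ dom (step f) → second x ∈ dom f
  step-query (_ , _ , _ , (q , p , r , ex , _ , fpr) , _) =
    r , resp f (𝔹.sym (second-≗ ex)) 𝔹.refl fpr

  step-total : ∀ {x r} → x ∈ dom (step f) → graph f (second x) r →
               ∃ (Φ-graph (first x) r)
  step-total {x} {r} (_ , ⊆U , _) fpr =
    let y , Uy = ⊆U _ (split x r fpr) in y , U⇒Φ 𝔹.refl Uy

  step-value : ∀ {x y} → graph (step f) x y →
               ∃[ r ] graph f (second x) r × Φ-graph (first x) r y
  step-value {x} {y} (_ , _ , (q , p , r , ex , ez , fpr) , Uy) =
    r , resp f (𝔹.sym (second-≗ ex)) 𝔹.refl fpr
      , Φ-resp {q} {first x} {r} {r} (𝔹.sym (first-≗ ex)) 𝔹.refl 𝔹.refl (U⇒Φ ez Uy)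

  step-intro : ∀ {x r y} → (∀ r → graph f (second x) r → ∃ (Φ-graph (first x) r)) →
               graph f (second x) r → Φ-graph (first x) r y → graph (step f) x y
  step-intro {x} {r} {y} values fpr s =
      (λ { z (q , p , r′ , ex , ez , fpr′) →
        let y′ , s′ = values r′ (resp f (𝔹.sym (second-≗ ex)) 𝔹.refl fpr′)
        in y′ , first x , r′
         , 𝔹.trans ez (⟪⟫-cong (𝔹.sym (first-≗ ex)) 𝔹.refl) , s′ })
    , ⟪ first x , r ⟫ , split x r fpr , first x , r , 𝔹.refl , s

-- The domain condition supplies a successor for every point of every stage; iterating it gives a
-- run.
run-exists : ∀ {f q} → q ∈ loopDom f → ∃ (IsRun f q)
run-exists {f} {q} d = (λ i → proj₁ (states i)) , 𝔹.refl , λ i →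
  proj₂ (d i (proj₂ (states i)))
  where
  states : ∀ i → ∃ (stage f q i)
  states zero    = q , 𝔹.refl
  states (suc i) = let x , x∈ = states i ; y , xy = d i x∈ in y , x , x∈ , xy

loop-total : ∀ {f q} → q ∈ loopDom f → q ∈ dom (loop f)
loop-total {f} {q} d = let s , run = run-exists {f} {q} d in
  tuple s , d , s , run , 𝔹.refl

-- `BaireSpace` is represented by pointwise equality, so names and points can be merged.
⊢-elim : ∀ {F f} → _⊢_ {BaireSpace} {BaireSpace} F f → ∀ {p} → p ∈ dom f →
         ∃[ q ] graph (multi F) p q × graph f p q
⊢-elim {F} {f} F⊢f {p} (r , fpr)
  with F⊢f {p} (r , (λ p′ p≗p′ → r , resp f p≗p′ 𝔹.refl fpr) , p , 𝔹.refl , fpr)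
... | q , Fpq , y , q≗y , _ , p′ , p≗p′ , fp′y =
  q , Fpq , resp f (𝔹.sym p≗p′) (𝔹.sym q≗y) fp′y

⊢-intro : ∀ {F f} →
          (∀ {p} → p ∈ dom f → ∃[ q ] graph (multi F) p q × graph f p q) →
          _⊢_ {BaireSpace} {BaireSpace} F f
⊢-intro value {p} (_ , id⊆f , _) =
  let q , Fpq , fpq = value (id⊆f p 𝔹.refl)
  in q , Fpq , q , 𝔹.refl , id⊆f , p , 𝔹.refl , fpq

-- Reading the run of `f` off the run of `g`.

-- Digit j of x is stored in digit pair 0 j of S x, which is digit
-- pair 0 j + pair 0 j of the simulation ⟪ S x , k ⟫ of x.
extract : Baire → Baire
extract t n = at 0 (decodeWord (proj₁ (unpair (t (pair i (k + k)) ∸ 3)))) 0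
  where
  i = proj₁ (unpair n)
  k = pair 0 (proj₂ (unpair n))

extractPosition : ℕ → ℕ
extractPosition n = pair (proj₁ (unpair n)) (k + k)
  where k = pair 0 (proj₂ (unpair n))

extract-modulus : Modulus extract (λ n → suc (extractPosition n))
extract-modulus = modulus λ n e →
  cong (λ d → at 0 (decodeWord (proj₁ (unpair (d ∸ 3)))) 0) (e ≤-refl)

extract-cong : ∀ {t t′} → t ≗ t′ → extract t ≗ extract t′
extract-cong {t} {t′} t≗t′ n =
  Modulus.local extract-modulus {t} {t′} n λ {i} _ → t≗t′ i

extraction : 𝔹 ⇀ 𝔹
extraction = record
  { multi = record
    { graph = λ t y → extract t ≗ y
    ; resp  = λ t≗t′ y≗y′ e →
        𝔹.trans (𝔹.sym (extract-cong t≗t′)) (𝔹.trans e y≗y′)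
    }
  ; functional = λ e e′ → 𝔹.trans (𝔹.sym e) e′
  }

extraction-computable : Computable extraction
extraction-computable = read , (code readCode , evaluates readCode) , read-mono ,
  λ {p} e → IsSup-resp (λ m → m) (λ m → m) e (read-sup p)
  where
  open Reader extract-modulus
  positionᵗ : ∀ {n} → Total Γ nat n → Total Γ nat (λ γ → extractPosition (n γ))
  positionᵗ ν = pairᵗ (fstᵗ ∘ᵗ unpairᵗ ν) (κ +ᵗ κ)
    where κ = pairᵗ zeroᵗ (sndᵗ ∘ᵗ unpairᵗ ν)
  readCode : Total (list nat) (list nat) read
  readCode = readᵗ
    (atᵗ zeroᵗ (decodeWordᵗ (fstᵗ ∘ᵗ unpairᵗ
       (atᵗ zeroᵗ fstᵗ (positionᵗ sndᵗ) ∸ᵗ sucᵗ (sucᵗ (sucᵗ zeroᵗ))))) zeroᵗ)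
    (sucᵗ (positionᵗ idᵗ)) idᵗ

-- The loop of `f` simulated by the loop of `g`.

module Simulation
  (f g : 𝔹 ⇉ 𝔹) (H K : 𝔹 ⇀ 𝔹) (cH : Computable H) (cK : Computable K)
  -- The pointwise content of a reduction: `K` finds an instance of `g`, and `H` copes with every
  -- answer to it.
  (query  : ∀ {p} → p ∈ dom f → ∃[ k ] graph (multi K) p k × k ∈ dom g)
  (answer : ∀ {p k r} → p ∈ dom f → graph (multi K) p k → graph g k r →
            ∃[ h ] graph (multi H) ⟪ p , r ⟫ h × graph f p h) where

  private
    toTotal : ∀ {F} (c : Computable F) → Total (list nat) (list nat) (proj₁ c)
    toTotal (_ , (c , e) , _) = total c e

    H-sup = proj₂ (proj₂ (proj₂ cH))
    K-sup = proj₂ (proj₂ (proj₂ cK))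

    module f = Step f
    module g = Step g

  open Translation (toTotal {H} cH) (toTotal {K} cK)
    (proj₁ (proj₂ (proj₂ cH))) (proj₁ (proj₂ (proj₂ cK)))

  translation : 𝔹 ⇀ 𝔹
  translation = record
    { multi = record
      { graph = λ x t → ∃[ k ] graph (multi K) (second x) k × t ≗ ⟪ S x , k ⟫
      ; resp  = λ { x≗x′ t≗t′ (k , Kpk , e) →
          k , resp (multi K) (λ j → x≗x′ (suc (j + j))) 𝔹.refl Kpk
            , 𝔹.trans (𝔹.sym t≗t′) (𝔹.trans e (⟪⟫-cong (S-cong x≗x′) 𝔹.refl)) }
      }
    ; functional = λ { (k , Kpk , e) (k′ , Kpk′ , e′) →
        𝔹.trans e (𝔹.trans (⟪⟫-cong 𝔹.refl (functional K Kpk Kpk′)) (𝔹.sym e′)) }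
    }

  translation-sup : ∀ {x t} → graph (multi translation) x t → IsSup (Image translate x) t
  translation-sup {x} (k , Kpk , e) =
    IsSup-resp (λ m → m) (λ m → m) (𝔹.sym e) (translate-sup {x} (K-sup Kpk))

  translation-computable : Computable translation
  translation-computable =
    translate , (code translateᵗ , evaluates translateᵗ) , translate-mono , translation-sup

  Simulates : Baire → Baire → Set
  Simulates t x = graph (multi translation) x t

  simulated : ∀ {x} → x ∈ dom (step f) → ∃[ t ] Simulates t x
  simulated {x} d = let k , Kpk , _ = query (f.step-query d) in
    ⟪ S x , k ⟫ , k , Kpk , 𝔹.refl

  module _ {x t} (sim : Simulates t x) (d : x ∈ dom (step f))
           (⊆dom : ∀ {y} → graph (step f) x y → y ∈ dom (step f)) where

    -- `H` turns the answer `r` into an answer of `f`, which determines a next state `y`. Simulating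
    -- `y` requires a value of `K` there, and `⊆dom` provides it.
    simulate-answer : ∀ {r} → graph g (second t) r →
      ∃[ y ] graph (step f) x y × ∃[ t′ ] Simulates t′ y × Φ-graph (first t) r t′
    simulate-answer {r} gr =
      let k , Kpk , e     = sim
          gkr             = resp g (second-≗ e) 𝔹.refl gr
          h , Hprh , fph  = answer (f.step-query d) Kpk gkr
          y , Φy          = f.step-total d fph
          xy              = f.step-intro (λ _ → f.step-total d) fph Φy
          t′ , sim′       = simulated (⊆dom xy)
          s               = S-simulates {x} {r} {h} {y} {t′}
                              (H-sup Hprh) Φy (translation-sup sim′)
      in y , xy , t′ , sim′
       , Φ-resp {S x} {first t} {r} {r} (𝔹.sym (first-≗ e)) 𝔹.refl 𝔹.refl s

    simulate-dom : t ∈ dom (step g)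
    simulate-dom =
      let k , Kpk , e = sim
          k′ , Kpk′ , r , gk′r = query (f.step-query d)
          gr = resp g (𝔹.trans (functional K Kpk′ Kpk) (𝔹.sym (second-≗ e))) 𝔹.refl gk′r
          _ , _ , t′ , _ , Φt′ = simulate-answer gr
      in t′ , g.step-intro
           (λ r′ gr′ → let _ , _ , t″ , _ , Φt″ = simulate-answer gr′ in t″ , Φt″) gr Φt′

    simulate-step : ∀ {t₁} → graph (step g) t t₁ →
                    ∃[ y ] graph (step f) x y × Simulates t₁ y
    simulate-step tt₁ =
      let r , gr , Φt₁ = g.step-value tt₁
          y , xy , t′ , sim′ , Φt′ = simulate-answer gr
      in y , xy , resp (multi translation) 𝔹.refl (IsSup-unique Φt′ Φt₁) sim′

  module _ {q₀ t₀} (d : q₀ ∈ loopDom f) (sim₀ : Simulates t₀ q₀) where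

    -- Together with `simulate-dom` this carries the domain condition, which concerns all reachable
    -- states, from `f` to `g`.
    stage-simulates : ∀ i {t} → stage g t₀ i t → ∃[ x ] stage f q₀ i x × Simulates t x
    stage-simulates zero t≗t₀ =
      q₀ , 𝔹.refl , resp (multi translation) 𝔹.refl (𝔹.sym t≗t₀) sim₀
    stage-simulates (suc i) (t′ , t′∈ , t′t) =
      let x , x∈ , sim = stage-simulates i t′∈
          y , xy , sim′ = simulate-step sim (d i x∈) (λ xy → d (suc i) (x , x∈ , xy)) t′t
      in y , (x , x∈ , xy) , sim′

    loopDom-simulates : t₀ ∈ loopDom g
    loopDom-simulates i t∈ =
      let x , x∈ , sim = stage-simulates i t∈
      in simulate-dom sim (d i x∈) (λ xy → d (suc i) (x , x∈ , xy))

    module _ {s′} (run′ : IsRun g t₀ s′) where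
      private
        -- Mutual with `next-state`: the run of `f` is built along the given run of `g`, whose
        -- answers decide each step.
        states : ∀ i → ∃[ x ] stage f q₀ i x × Simulates (s′ i) x

        next-state : ∀ i → let x , _ = states i in
                     ∃[ y ] graph (step f) x y × Simulates (s′ (suc i)) y
        next-state i = let x , x∈ , sim = states i in
          simulate-step sim (d i x∈) (λ xy → d (suc i) (x , x∈ , xy)) (proj₂ run′ i)

        states zero    =
          q₀ , 𝔹.refl , resp (multi translation) 𝔹.refl (𝔹.sym (proj₁ run′)) sim₀
        states (suc i) =
          let y , xy , sim = next-state i
          in y , (proj₁ (states i) , proj₁ (proj₂ (states i)) , xy) , sim

      run-simulates : ∃[ s ] IsRun f q₀ s × (∀ i → Simulates (s′ i) (s i))
      run-simulates = (λ i → proj₁ (states i))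
        , (𝔹.refl , λ i → proj₁ (proj₂ (next-state i)))
        , λ i → proj₂ (proj₂ (states i))

  extract-tuple : ∀ {s s′} → (∀ i → Simulates (s′ i) (s i)) → extract (tuple s′) ≗ tuple s
  extract-tuple {s} {s′} sim n = begin
    D (tuple s′ (pair i (k + k)))                           ≡⟨ cong D (tuple-pair s′ i (k + k)) ⟩
    D (s′ i (k + k))                                        ≡⟨ cong D (first-≗ e k) ⟩
    D (S (s i) k)                                           ≡⟨ cong D (S-stores (s i) j) ⟩
    D (3 + pair (codeWord (s i j ∷ [])) 0)
      ≡⟨ cong (λ c → at 0 (decodeWord (proj₁ c)) 0) (unpair-pair (codeWord (s i j ∷ [])) 0) ⟩
    at 0 (decodeWord (codeWord (s i j ∷ []))) 0
      ≡⟨ cong (λ w → at 0 w 0) (decodeWord-codeWord (s i j ∷ [])) ⟩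
    s i j                                                   ∎
    where
    open ≡-Reasoning
    i = proj₁ (unpair n)
    j = proj₂ (unpair n)
    k = pair 0 j
    e = proj₂ (proj₂ (sim i))
    D : ℕ → ℕ
    D d = at 0 (decodeWord (proj₁ (unpair (d ∸ 3)))) 0

  loop-extract : ∀ {p t v} → p ∈ loopDom f → Simulates t p → graph (loop g) t v →
                 graph (loop f) p (extract v)
  loop-extract {p} {t} d sim (_ , s′ , run′ , v≗) =
    let s , run , sims = run-simulates {p} {t} d sim {s′} run′
    in d , s , run , 𝔹.trans (extract-cong v≗) (extract-tuple {s} {s′} sims)

  loop-reduces : ∀ G → _⊢_ {BaireSpace} {BaireSpace} G (loop g) →
    _⊢_ {BaireSpace} {BaireSpace} (extraction ∘ₚ G ∘ₚ translation) (loop f)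
  loop-reduces G G⊢g∞ = ⊢-intro {extraction ∘ₚ G ∘ₚ translation} {loop f} λ {p} (_ , d , _) →
    let t , sim        = simulated {p} (d 0 𝔹.refl)
        -- The composition demands a value of `G` at every simulation of `p`, not only at the chosen
        -- `t`.
        G-value′       = λ t sim → G-value {p} {t} d sim
        u , Gtu , gtu  = G-value′ t sim
    in extract u
     , ( (λ u _ → extract u , 𝔹.refl)
       , u
       , ((λ t′ sim′ → let u′ , Gtu′ , _ = G-value′ t′ sim′ in u′ , Gtu′) , t , sim , Gtu)
       , 𝔹.refl)
     , loop-extract {p} {t} {u} d sim gtu
    where
    G-value : ∀ {p t} → p ∈ loopDom f → Simulates t p →
              ∃[ u ] graph (multi G) t u × graph (loop g) t u
    G-value {p} {t} d sim =
      ⊢-elim {G} {loop g} G⊢g∞ {t} (loop-total {g} {t} (loopDom-simulates {p} {t} d sim))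

-- The pointwise content of a Weihrauch reduction.

module Reduction
  (em : ExcludedMiddle 0ℓ) {X Y Z W : RepresentedSpace} (f : Problem X Y) (g : Problem Z W)
  {H K : 𝔹 ⇀ 𝔹}
  (reduces : ∀ G → _⊢_ {Z} {W} G (fun g) → _⊢_ {X} {Y} (H ∘ₚ ⟨id, G ∘ₚ K ⟩) (fun f)) where

  private
    module Y = RepresentedSpace Y
    module W = RepresentedSpace W
    fʳ = fun (f ʳ)
    gʳ = fun (g ʳ)
    gδ = fun g ∘ₘ rep Z
    fδ = fun f ∘ₘ rep X
    G  = proj₁ (realizer g)

  -- Surjectivity of the representation supplies the names that the domain condition of the
  -- composition asks for.
  ʳ-intro : ∀ {p r y} → graph fδ p y → graph (rep Y) r y → graph fʳ p r
  ʳ-intro {y = y} fpy δry = (λ y′ _ → Y.surjective y′) , y , fpy , δry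

  -- A realizer may have values outside the domain of `g`. Once these are cut off, a successful run
  -- of the reduction proves that `K` has produced an instance of `g`.
  restricted : 𝔹 ⇀ 𝔹
  restricted = record
    { multi = record
      { graph = λ x y → x ∈ dom gʳ × graph (multi G) x y
      ; resp  = λ { {x} x≗x′ y≗y′ ((z , gxz) , Gxy) →
          (z , resp gʳ {x} x≗x′ 𝔹.refl gxz) , resp (multi G) x≗x′ y≗y′ Gxy }
      }
    ; functional = λ (_ , Gxy) (_ , Gxy′) → functional G Gxy Gxy′
    }

  restricted-realizes : _⊢_ {Z} {W} restricted (fun g)
  restricted-realizes (z , gxz) =
    let q , Gxq , w , δqw , gxw = proj₂ (realizer g) (z , gxz)
        r , δrz = W.surjective z
    in q , ((r , (λ w′ _ → W.surjective w′) , z , gxz , δrz) , Gxq) , w , δqw , gxw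

  query : ∀ {p} → p ∈ dom fʳ → ∃[ k ] graph (multi K) p k × k ∈ dom gʳ
  query (_ , _ , y , fpy , _) with reduces restricted restricted-realizes (y , fpy)
  ... | _ , (_ , _ , (_ , (_ , k , Kpk , k∈ , _) , _) , _) , _ = k , Kpk , k∈

  -- H only has to work for answers given by some realizer of g.  Excluded
  -- middle provides a realizer that gives the answer r to k.
  module _ {k r} (gkr : graph gʳ k r) where

    redirected : 𝔹 ⇀ 𝔹
    redirected = record
      { multi = record
        { graph = λ x y → (x ≗ k × y ≗ r) ⊎ (¬ x ≗ k × graph (multi G) x y)
        ; resp  = λ
            { x≗x′ y≗y′ (inj₁ (x≗k , y≗r)) →
                inj₁ (𝔹.trans (𝔹.sym x≗x′) x≗k , 𝔹.trans (𝔹.sym y≗y′) y≗r)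
            ; x≗x′ y≗y′ (inj₂ (x≉k , Gxy)) →
                inj₂ ((λ x′≗k → x≉k (𝔹.trans x≗x′ x′≗k)) , resp (multi G) x≗x′ y≗y′ Gxy) }
        }
      ; functional = λ
          { (inj₁ (_ , y≗r)) (inj₁ (_ , y′≗r))     → 𝔹.trans y≗r (𝔹.sym y′≗r)
          ; (inj₁ (x≗k , _)) (inj₂ (x≉k , _))      → contradiction x≗k x≉k
          ; (inj₂ (x≉k , _)) (inj₁ (x≗k , _))      → contradiction x≗k x≉k
          ; (inj₂ (_ , Gxy)) (inj₂ (_ , Gxy′))     → functional G Gxy Gxy′ }
      }

    redirected-realizes : _⊢_ {Z} {W} redirected (fun g)
    redirected-realizes {x} x∈ with em {P = x ≗ k}
    ... | yes x≗k = let _ , w , gkw , δrw = gkr in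
      r , inj₁ (x≗k , 𝔹.refl) , w , δrw
        , resp gδ {k} {x} {w} (𝔹.sym x≗k) (Setoid.refl (setoid W)) gkw
    ... | no x≉k  = let q , Gxq , w , δqw , gxw = proj₂ (realizer g) x∈ in
      q , inj₂ (x≉k , Gxq) , w , δqw , gxw

  answer : ∀ {p k r} → p ∈ dom fʳ → graph (multi K) p k → graph gʳ k r →
           ∃[ h ] graph (multi H) ⟪ p , r ⟫ h × graph fʳ p h
  answer (_ , _ , y , fpy , _) Kpk gkr
    with reduces (redirected gkr) (redirected-realizes gkr) (y , fpy)
  ... | h , (_ , z , (m , (_ , k′ , Kpk′ , inj₁ (_ , m≗r)) , z≗) , Hzh) , y′ , δhy′ , fpy′ =
    h , resp (multi H) (𝔹.trans z≗ (⟪⟫-cong 𝔹.refl m≗r)) 𝔹.refl Hzh , ʳ-intro fpy′ δhy′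
  -- `K` has only one value at the given point, so the realizer was asked at `k` itself.
  ... | h , (_ , z , (m , (_ , k′ , Kpk′ , inj₂ (k′≉k , _)) , z≗) , Hzh) , _ =
    contradiction (functional K Kpk′ Kpk) k′≉k

proposition13 : ExcludedMiddle 0ℓ →
    ∀ {X Y Z W : RepresentedSpace} (f : Problem X Y) (g : Problem Z W) →
    f ≤W g → (f ^∞) ≤sW (g ^∞)
proposition13 em f g (H , K , cH , cK , reduces) =
  -- `extraction` sees only the run of `g`, in which the run of `f` is stored; hence the reduction
  -- is strong.
  extraction , translation , extraction-computable , translation-computable , loop-reduces
  where
  open Reduction em f g {H} {K} reduces
  open Simulation (fun (f ʳ)) (fun (g ʳ)) H K cH cK query answer
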